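{- For every integer $k\ge 2$ there is a number $c_k$ with $$\frac{\pi^2}{6}\;\le\; c_k\;\le\;\frac{\pi^2}{6}+\frac{1}{(k-1)k}$$ such that, for every strongly connected digraph $G$, the algorithm $\textsc{Contract-Cycles}_k(G)$ returns at most $c_k\cdot \mathcal{OPT}(G)$ edges.
   Context: "Cycle" means a simple directed cycle; a 2-cycle consists of edges $(u,v),(v,u)$. An SCSS (strongly connected spanning subgraph) of a strongly connected digraph $G$ is a subset of the edges that strongly connects all vertices of $G$; $\mathcal{OPT}(G)$ is the minimum number of edges in an SCSS of $G$. To contract a pair of vertices $u,v$ is to replace $u$ and $v$ (and each occurrence of them in any edge) by a single new vertex, and to delete any subsequent self-loops and multi-edges. Each edge of the resulting graph is identified with the corresponding edge of the original graph (in the case of multi-edges, the single remaining edge is identified with any one of the corresponding original edges). To contract an edge is to contract its pair of endpoints; to contract a set of edges is to contract them in arbitrary order. Algorithm $\textsc{Contract-Cycles}_k(G)$: for $i=k,k-1,\dots,2$ in turn, while the current (contracted) graph contains a cycle with at least $i$ edges, contract the edges on such a cycle. Return the set of all contracted edges (identified with edges of $G$). -}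

module Defs where

open import Data.Nat.Base as ℕ using (ℕ; zero; suc; z≤n; s≤s)
import Data.Nat.Properties as ℕ
open import Data.Integer.Base as ℤ using (+_; +[1+_]; -[1+_])
import Data.Integer.Properties as ℤ
open import Data.Rational.Base
open import Data.Rational.Properties hiding (_≟_)
open import Data.Rational.Solver using (module +-*-Solver)
import Data.Rational.Unnormalised.Base as ℚᵘ
import Data.Rational.Unnormalised.Properties as ℚᵘ
open import Data.Bool.Base using (if_then_else_)
open import Data.Empty using (⊥)
open import Data.Fin.Base using (Fin)
open import Data.Fin.Properties using (_≟_)
import Data.Fin.Subset as Sub
open import Data.Fin.Subset using (Subset; _∈_; _⊆_; _∪_; ⋃; ⁅_⁆)
open import Data.List.Base using (List; []; _∷_; _∷ʳ_; length; map)
open import Data.List.Relation.Binary.Permutation.Propositional using (_↭_)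
open import Data.List.Relation.Unary.All using (All)
open import Data.List.Relation.Unary.Linked using (Linked)
open import Data.List.Relation.Unary.Unique.Propositional using (Unique)
open import Data.Product.Base using (∃; ∃-syntax; _×_; _,_; proj₁; proj₂)
open import Function.Base using (id)
open import Relation.Binary.Construct.Closure.ReflexiveTransitive using (Star)
open import Relation.Binary.PropositionalEquality
open import Relation.Nullary using (¬_; does)

------------------------------------------------------------------------
-- Real numbers

Cauchy : (ℕ → ℚ) → Set
Cauchy x = ∀ ε → 0ℚ < ε →
  ∃[ N ] (∀ m n → N ℕ.≤ m → N ℕ.≤ n → ∣ x m - x n ∣ ≤ ε)

-- There is no quotient: two reals x and y count as equal when x ≤ʳ y and
-- y ≤ʳ x.
record ℝ : Set where
  constructor real
  field
    approx : ℕ → ℚ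
    cauchy : Cauchy approx

open ℝ public

infix  4 _≤ʳ_
infixl 6 _+ʳ_
infixl 7 _*ʳ_

_≤ʳ_ : ℝ → ℝ → Set
x ≤ʳ y = ∀ ε → 0ℚ < ε →
  ∃[ N ] (∀ n → N ℕ.≤ n → approx x n ≤ approx y n + ε)

private
  halves : ∀ ε → ε * ½ + ε * ½ ≡ ε
  halves ε = trans (sym (*-distribˡ-+ ε ½ ½)) (*-identityʳ ε)

  half>0 : ∀ {ε} → 0ℚ < ε → 0ℚ < ε * ½
  half>0 {ε} h = positive⁻¹ _ {{pos*pos⇒pos ε {{positive h}} ½}}

  +-cauchy : ∀ x y → Cauchy x → Cauchy y → Cauchy (λ n → x n + y n)
  +-cauchy x y cx cy ε ε>0 with cx (ε * ½) (half>0 ε>0) | cy (ε * ½) (half>0 ε>0)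
  ... | M , p | N , q = M ℕ.⊔ N , λ m n hm hn →
    let open ≤-Reasoning in begin
    ∣ (x m + y m) - (x n + y n) ∣
      ≡⟨ cong ∣_∣ (solve 4 (λ a b c d → (a :+ b) :- (c :+ d) := (a :- c) :+ (b :- d))
                     refl (x m) (y m) (x n) (y n)) ⟩
    ∣ (x m - x n) + (y m - y n) ∣     ≤⟨ ∣p+q∣≤∣p∣+∣q∣ (x m - x n) (y m - y n) ⟩
    ∣ x m - x n ∣ + ∣ y m - y n ∣
      ≤⟨ +-mono-≤ (p m n (ℕ.m⊔n≤o⇒m≤o M N hm) (ℕ.m⊔n≤o⇒m≤o M N hn))
                  (q m n (ℕ.m⊔n≤o⇒n≤o M N hm) (ℕ.m⊔n≤o⇒n≤o M N hn)) ⟩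
    ε * ½ + ε * ½                     ≡⟨ halves ε ⟩
    ε                                 ∎
    where open +-*-Solver

  eventuallyBounded : ∀ x → Cauchy x →
    ∃[ B ] (0ℚ < B × ∃[ N ] (∀ n → N ℕ.≤ n → ∣ x n ∣ ≤ B))
  eventuallyBounded x cx with cx 1ℚ (positive⁻¹ 1ℚ)
  ... | N , p = ∣ x N ∣ + 1ℚ , +-mono-≤-< (0≤∣p∣ (x N)) (positive⁻¹ 1ℚ) , N , λ n hn →
    let open ≤-Reasoning in begin
    ∣ x n ∣                 ≡⟨ cong ∣_∣ (solve 2 (λ a b → a := b :+ (a :- b)) refl (x n) (x N)) ⟩
    ∣ x N + (x n - x N) ∣   ≤⟨ ∣p+q∣≤∣p∣+∣q∣ (x N) (x n - x N) ⟩
    ∣ x N ∣ + ∣ x n - x N ∣ ≤⟨ +-monoʳ-≤ ∣ x N ∣ (p n N hn ℕ.≤-refl) ⟩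
    ∣ x N ∣ + 1ℚ            ∎
    where open +-*-Solver

  divide : ∀ B ε → 0ℚ < B → 0ℚ < ε → ∃[ δ ] (0ℚ < δ × B * δ ≡ ε)
  divide B ε B>0 ε>0 = 1/B * ε , positive⁻¹ _ {{pos*pos⇒pos 1/B {{1/pos⇒pos B}} ε}} ,
    trans (sym (*-assoc B 1/B ε)) (trans (cong (_* ε) (*-inverseʳ B)) (*-identityˡ ε))
    where
    instance
      posB : Positive B
      posB = positive B>0
      posε : Positive ε
      posε = positive ε>0
      nzB : NonZero B
      nzB = pos⇒nonZero B
    1/B = 1/ B

  *-mono-∣∣ : ∀ {a b B δ} → 0ℚ < B → ∣ a ∣ ≤ B → ∣ b ∣ ≤ δ → ∣ a * b ∣ ≤ B * δ
  *-mono-∣∣ {a} {b} {B} {δ} B>0 p q = let open ≤-Reasoning in begin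
    ∣ a * b ∣     ≡⟨ ∣p*q∣≡∣p∣*∣q∣ a b ⟩
    ∣ a ∣ * ∣ b ∣ ≤⟨ *-monoʳ-≤-nonNeg ∣ b ∣ {{∣-∣-nonNeg b}} p ⟩
    B * ∣ b ∣     ≤⟨ *-monoˡ-≤-nonNeg B {{pos⇒nonNeg B {{positive B>0}}}} q ⟩
    B * δ         ∎

  product-difference : ∀ a b c d → a * b - c * d ≡ a * (b - d) + d * (a - c)
  product-difference = solve 4 (λ a b c d →
    a :* b :- c :* d := a :* (b :- d) :+ d :* (a :- c)) refl
    where open +-*-Solver

  product-close : ∀ {a b c d B C δ η} → 0ℚ < B → 0ℚ < C →
    ∣ a ∣ ≤ B → ∣ d ∣ ≤ C → ∣ b - d ∣ ≤ δ → ∣ a - c ∣ ≤ η →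
    ∣ a * b - c * d ∣ ≤ B * δ + C * η
  product-close {a} {b} {c} {d} {B} {C} {δ} {η} B>0 C>0 a≤B d≤C b-d a-c =
    let open ≤-Reasoning in begin
    ∣ a * b - c * d ∣                   ≡⟨ cong ∣_∣ (product-difference a b c d) ⟩
    ∣ a * (b - d) + d * (a - c) ∣       ≤⟨ ∣p+q∣≤∣p∣+∣q∣ (a * (b - d)) (d * (a - c)) ⟩
    ∣ a * (b - d) ∣ + ∣ d * (a - c) ∣
      ≤⟨ +-mono-≤ (*-mono-∣∣ {a} {b - d} B>0 a≤B b-d) (*-mono-∣∣ {d} {a - c} C>0 d≤C a-c) ⟩
    B * δ + C * η                       ∎

  *-cauchy : ∀ x y → Cauchy x → Cauchy y → Cauchy (λ n → x n * y n)
  *-cauchy x y cx cy ε ε>0 =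
    let B , B>0 , K , bx = eventuallyBounded x cx
        C , C>0 , L , by = eventuallyBounded y cy
        δ , δ>0 , Bδ     = divide B (ε * ½) B>0 (half>0 ε>0)
        η , η>0 , Cη     = divide C (ε * ½) C>0 (half>0 ε>0)
        M , p            = cx η η>0
        N , q            = cy δ δ>0
        KL = K ℕ.⊔ L
        MN = M ℕ.⊔ N
    in KL ℕ.⊔ MN , λ m n hm hn →
      let klm = ℕ.m⊔n≤o⇒m≤o KL MN hm
          mnm = ℕ.m⊔n≤o⇒n≤o KL MN hm
          kln = ℕ.m⊔n≤o⇒m≤o KL MN hn
          mnn = ℕ.m⊔n≤o⇒n≤o KL MN hn
      in ≤-trans
           (product-close {x m} {y m} {x n} {y n} B>0 C>0
             (bx m (ℕ.m⊔n≤o⇒m≤o K L klm)) (by n (ℕ.m⊔n≤o⇒n≤o K L kln))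
             (q m n (ℕ.m⊔n≤o⇒n≤o M N mnm) (ℕ.m⊔n≤o⇒n≤o M N mnn))
             (p m n (ℕ.m⊔n≤o⇒m≤o M N mnm) (ℕ.m⊔n≤o⇒m≤o M N mnn)))
           (≤-reflexive (trans (cong₂ _+_ Bδ Cη) (halves ε)))

_+ʳ_ : ℝ → ℝ → ℝ
real x cx +ʳ real y cy = real (λ n → x n + y n) (+-cauchy x y cx cy)

_*ʳ_ : ℝ → ℝ → ℝ
real x cx *ʳ real y cy = real (λ n → x n * y n) (*-cauchy x y cx cy)

fromℚ : ℚ → ℝ
fromℚ q = real (λ _ → q) λ ε ε>0 → 0 , λ _ _ _ _ →
  ≤-trans (≤-reflexive (cong ∣_∣ (+-inverseʳ q))) (<⇒≤ ε>0)

fromℕ : ℕ → ℝ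
fromℕ n = fromℚ (+ n / 1)

------------------------------------------------------------------------
-- The number π

-- 1/(2n+1)
oddRecip : ℕ → ℚ
oddRecip n = + 1 / suc (2 ℕ.* n)

alternating : ℕ → ℚ
alternating zero    = 1ℚ
alternating (suc n) = - alternating n

-- leibniz n = 1 - 1/3 + 1/5 - ⋯, with n terms
leibniz : ℕ → ℚ
leibniz zero    = 0ℚ
leibniz (suc n) = leibniz n + alternating n * oddRecip n

private
  recip-antitone : ∀ {m n} → m ℕ.≤ n → + 1 / suc n ≤ + 1 / suc m
  recip-antitone {m} {n} m≤n = toℚᵘ-cancel-≤ (begin
    toℚᵘ (+ 1 / suc n) ≃⟨ toℚᵘ-fromℚᵘ (ℚᵘ.mkℚᵘ (+ 1) n) ⟩
    ℚᵘ.mkℚᵘ (+ 1) n    ≤⟨ ℚᵘ.*≤* (ℤ.+≤+ (ℕ.+-monoˡ-≤ 0 (s≤s m≤n))) ⟩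
    ℚᵘ.mkℚᵘ (+ 1) m    ≃⟨ ℚᵘ.≃-sym (toℚᵘ-fromℚᵘ (ℚᵘ.mkℚᵘ (+ 1) m)) ⟩
    toℚᵘ (+ 1 / suc m) ∎)
    where open ℚᵘ.≤-Reasoning

  archimedean : ∀ ε → 0ℚ < ε → ∃[ N ] + 1 / suc N ≤ ε
  archimedean ε@(mkℚ +[1+ p ] d c) _ = d , toℚᵘ-cancel-≤ (begin
    toℚᵘ (+ 1 / suc d)    ≃⟨ toℚᵘ-fromℚᵘ (ℚᵘ.mkℚᵘ (+ 1) d) ⟩
    ℚᵘ.mkℚᵘ (+ 1) d       ≤⟨ ℚᵘ.*≤* (ℤ.+≤+ (ℕ.*-monoˡ-≤ (suc d) (s≤s (z≤n {p})))) ⟩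
    ℚᵘ.mkℚᵘ +[1+ p ] d    ∎)
    where open ℚᵘ.≤-Reasoning
  archimedean (mkℚ (+ zero) d c) (*<* (ℤ.+<+ ()))
  archimedean (mkℚ -[1+ _ ] d c) (*<* ())

  -- tail N j = 1/(2N+1) - 1/(2N+3) + ⋯, with j terms
  tail : ℕ → ℕ → ℚ
  tail N zero    = 0ℚ
  tail N (suc j) = oddRecip N - tail (suc N) j

  oddRecip-antitone : ∀ N → oddRecip (suc N) ≤ oddRecip N
  oddRecip-antitone N = recip-antitone (ℕ.*-monoʳ-≤ 2 (ℕ.n≤1+n N))

  tail-bounds : ∀ N j → 0ℚ ≤ tail N j × tail N j ≤ oddRecip N
  tail-bounds N zero    = ≤-refl , nonNegative⁻¹ (oddRecip N) {{normalize-nonNeg 1 (suc (2 ℕ.* N))}}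
  tail-bounds N (suc j) with tail-bounds (suc N) j
  ... | lo , hi =
      ≤-trans (≤-reflexive (sym (+-inverseʳ (oddRecip N))))
        (+-monoʳ-≤ (oddRecip N) (neg-antimono-≤ (≤-trans hi (oddRecip-antitone N))))
    , ≤-trans (+-monoʳ-≤ (oddRecip N) (neg-antimono-≤ lo)) (≤-reflexive (+-identityʳ (oddRecip N)))

  leibniz-tail : ∀ N j → leibniz (N ℕ.+ j) ≡ leibniz N + alternating N * tail N j
  leibniz-tail N zero    = trans (cong leibniz (ℕ.+-identityʳ N))
    (solve 2 (λ l s → l := l :+ s :* con 0ℚ) refl (leibniz N) (alternating N))
    where open +-*-Solver
  leibniz-tail N (suc j) = trans (cong leibniz (ℕ.+-suc N j)) (trans (leibniz-tail (suc N) j)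
    (solve 4 (λ l s a t → (l :+ s :* a) :+ (:- s) :* t := l :+ s :* (a :- t)) refl
      (leibniz N) (alternating N) (oddRecip N) (tail (suc N) j)))
    where open +-*-Solver

  ∣alternating∣ : ∀ n → ∣ alternating n ∣ ≡ 1ℚ
  ∣alternating∣ zero    = refl
  ∣alternating∣ (suc n) = trans (∣-p∣≡∣p∣ (alternating n)) (∣alternating∣ n)

  leibniz-close : ∀ {N m} → N ℕ.≤ m → ∣ leibniz m - leibniz N ∣ ≤ + 1 / suc N
  leibniz-close {N} {m} N≤m = let open ≤-Reasoning in begin
    ∣ leibniz m - leibniz N ∣
      ≡⟨ cong (λ i → ∣ leibniz i - leibniz N ∣) (sym (ℕ.m+[n∸m]≡n N≤m)) ⟩
    ∣ leibniz (N ℕ.+ j) - leibniz N ∣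
      ≡⟨ cong (λ q → ∣ q - leibniz N ∣) (leibniz-tail N j) ⟩
    ∣ (leibniz N + alternating N * tail N j) - leibniz N ∣
      ≡⟨ cong ∣_∣ (solve 2 (λ l t → (l :+ t) :- l := t) refl (leibniz N) (alternating N * tail N j)) ⟩
    ∣ alternating N * tail N j ∣     ≡⟨ ∣p*q∣≡∣p∣*∣q∣ (alternating N) (tail N j) ⟩
    ∣ alternating N ∣ * ∣ tail N j ∣ ≡⟨ cong₂ _*_ (∣alternating∣ N) (0≤p⇒∣p∣≡p (proj₁ (tail-bounds N j))) ⟩
    1ℚ * tail N j                    ≡⟨ *-identityˡ (tail N j) ⟩
    tail N j                         ≤⟨ proj₂ (tail-bounds N j) ⟩
    oddRecip N                       ≤⟨ recip-antitone (ℕ.m≤m+n N _) ⟩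
    + 1 / suc N                      ∎
    where
    open +-*-Solver
    j = m ℕ.∸ N

leibniz-cauchy : Cauchy leibniz
leibniz-cauchy ε ε>0 with archimedean (ε * ½) (half>0 ε>0)
... | N , 1/N≤ε/2 = N , λ m n N≤m N≤n → let open ≤-Reasoning in begin
  ∣ leibniz m - leibniz n ∣
    ≡⟨ cong ∣_∣ (solve 3 (λ a b c → a :- b := (a :- c) :- (b :- c)) refl
                   (leibniz m) (leibniz n) (leibniz N)) ⟩
  ∣ (leibniz m - leibniz N) - (leibniz n - leibniz N) ∣   ≤⟨ ∣p-q∣≤∣p∣+∣q∣ (leibniz m - leibniz N) (leibniz n - leibniz N) ⟩
  ∣ leibniz m - leibniz N ∣ + ∣ leibniz n - leibniz N ∣
    ≤⟨ +-mono-≤ (≤-trans (leibniz-close N≤m) 1/N≤ε/2) (≤-trans (leibniz-close N≤n) 1/N≤ε/2) ⟩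
  ε * ½ + ε * ½                                           ≡⟨ halves ε ⟩
  ε                                                       ∎
  where open +-*-Solver

-- The Leibniz series π = 4 (1 - 1/3 + 1/5 - ⋯) serves as the definition.
π : ℝ
π = fromℕ 4 *ʳ real leibniz leibniz-cauchy

π²/6 : ℝ
π²/6 = π *ʳ π *ʳ fromℚ (+ 1 / 6)

1/[k-1]k : ∀ k → 2 ℕ.≤ k → ℝ
1/[k-1]k k@(suc (suc j)) _ = fromℚ (+ 1 / (suc j ℕ.* k))
1/[k-1]k zero       ()
1/[k-1]k (suc zero) (s≤s ())

------------------------------------------------------------------------
-- Digraphs

-- Edges carry names in Fin #E, so that the edges of a contracted graph can be
-- identified with edges of the original one; by `simple` an edge is
-- determined by its ordered pair of endpoints.
record Digraph : Set where
  field
    #V #E   : ℕ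
    src tgt : Fin #E → Fin #V
    simple  : ∀ {e f} → src e ≡ src f → tgt e ≡ tgt f → e ≡ f

module _ (G : Digraph) where
  open Digraph G

  Vertex Edge EdgeSet : Set
  Vertex  = Fin #V
  Edge    = Fin #E
  EdgeSet = Subset #E

  record Step (S : EdgeSet) (u v : Vertex) : Set where
    field
      edge   : Edge
      chosen : edge ∈ S
      from   : src edge ≡ u
      to     : tgt edge ≡ v

  SCSS : EdgeSet → Set
  SCSS S = ∀ u v → Star (Step S) u v

  StronglyConnected : Set
  StronglyConnected = SCSS Sub.⊤

  -- OPT o says that o is the minimum number of edges in an SCSS of G.
  record OPT (o : ℕ) : Set where
    field
      attained : ∃[ S ] (SCSS S × Sub.∣ S ∣ ≡ o)
      minimal  : ∀ S → SCSS S → o ℕ.≤ Sub.∣ S ∣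

  ----------------------------------------------------------------------
  -- Contraction

  -- A graph obtained from G by contractions. Its vertices are named by
  -- vertices of G: `rep w` is the vertex that w has been merged into, and the
  -- vertex set is the image of `rep`. `live` is the set of remaining edges.
  record Contracted : Set where
    field
      rep  : Vertex → Vertex
      live : EdgeSet

    source target : Edge → Vertex
    source e = rep (src e)
    target e = rep (tgt e)

    Loop : Edge → Set
    Loop e = source e ≡ target e

    Parallel : Edge → Edge → Set
    Parallel e f = source e ≡ source f × target e ≡ target f

    -- The edges of a simple directed cycle, in order.
    Cycle : List Edge → Set
    Cycle []       = ⊥
    Cycle (e ∷ es) =
        All (_∈ live) (e ∷ es)
      × Linked (λ f g → target f ≡ source g) (e ∷ es ∷ʳ e)
      × Unique (map source (e ∷ es))

  open Contracted

  uncontracted : Contracted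
  uncontracted = record { rep = id ; live = Sub.⊤ }

  -- The new vertex replacing u and v reuses the name u.
  merge : Vertex → Vertex → Vertex → Vertex
  merge u v w = if does (w ≟ v) then u else w

  -- H′ arises from H by contracting the pair of vertices u, v.  This is a
  -- relation because any one edge of a class of parallel edges may survive.
  record ContractPair (u v : Vertex) (H H′ : Contracted) : Set where
    field
      merged     : ∀ w → rep H′ w ≡ merge u v (rep H w)
      subgraph   : live H′ ⊆ live H
      loopless   : ∀ {e} → e ∈ live H′ → ¬ Loop H′ e
      noParallel : ∀ {e f} → e ∈ live H′ → f ∈ live H′ → Parallel H′ e f → e ≡ f
      kept       : ∀ {e} → e ∈ live H → ¬ Loop H′ e →
                   ∃[ f ] (f ∈ live H′ × Parallel H′ e f)

  ContractEdge : Edge → Contracted → Contracted → Set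
  ContractEdge e H = ContractPair (source H e) (target H e) H

  -- The endpoints of an edge are taken in the graph current when its turn
  -- comes, even if it has by then become a loop or given way to a parallel
  -- edge.
  data ContractInOrder : List Edge → Contracted → Contracted → Set where
    []  : ∀ {H} → ContractInOrder [] H H
    _∷_ : ∀ {e es H H′ H″} → ContractEdge e H H′ → ContractInOrder es H′ H″ →
          ContractInOrder (e ∷ es) H H″

  ContractEdges : List Edge → Contracted → Contracted → Set
  ContractEdges es H H′ = ∃[ es′ ] (es′ ↭ es × ContractInOrder es′ H H′)

  ----------------------------------------------------------------------
  -- The algorithm

  -- One iteration of the for loop: Phase i H F H′ F′ says that contracting
  -- cycles with at least i edges for as long as there are any can lead from
  -- graph H to H′ and enlarge the set of contracted edges from F to F′.
  data Phase (i : ℕ) : Contracted → EdgeSet → Contracted → EdgeSet → Set where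
    exit : ∀ {H F} →
           ¬ (∃[ es ] (Cycle H es × i ℕ.≤ length es)) →
           Phase i H F H F
    step : ∀ {H F H′ H″ F″} es → Cycle H es → i ℕ.≤ length es →
           ContractEdges es H H′ →
           Phase i H′ (F ∪ ⋃ (map ⁅_⁆ es)) H″ F″ →
           Phase i H F H″ F″

  -- Run i H F F′: the phases i, i - 1, …, 2, started with graph H and
  -- contracted edges F, can return F′.
  data Run : ℕ → Contracted → EdgeSet → EdgeSet → Set where
    return : ∀ {H F} → Run 1 H F F
    phase  : ∀ {i H F H′ F′ F″} → 2 ℕ.≤ i →
             Phase i H F H′ F′ →
             Run (ℕ.pred i) H′ F′ F″ →
             Run i H F F″

-- ContractCycles k G F: some run of the algorithm with parameter k on G
-- returns F.
ContractCycles : ℕ → (G : Digraph) → EdgeSet G → Set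
ContractCycles k G F = Run G k (uncontracted G) Sub.⊥ F

{-# OPTIONS --safe #-}

-- Contracting a cycle with ℓ ≥ i edges removes ℓ - 1 vertices, so phase i pays at
-- most i/(i-1) edges per vertex removed.  If no cycle of a contracted graph with n
-- vertices has more than i edges, then OPT ≥ i/(i-1) (n - 1): build up an optimal
-- SCSS by ears; an ear closes to a simple cycle, so it has at most i - 1 new
-- vertices, and one edge more.  Summing over the phases by parts yields the ratio
-- c_k = 1/(k-1) + Σ_{j<k} 1/j², and 1/k ≤ Σ_{j≥k} 1/j² ≤ 1/(k-1).
--
-- Euler's Σ 1/j² = π²/6 follows by squaring the Leibniz series.  With L_N its partial
-- sum, partial fractions turn 2 L_N² - Σ_{n<N} 1/(2n+1)² into a sum of alternating
-- harmonic blocks starting at N - n and weighted by 1/(2n+1); a block is at most its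
-- first term, so the sum is O(log N / N).

module Submission where

open import Data.Nat.Base as ℕ using (ℕ; zero; suc; z≤n; s≤s)
import Data.Nat.Properties as ℕ
open import Data.Nat.Tactic.RingSolver using () renaming (solve-∀ to solveℕ)
open import Data.Integer.Base as ℤ using (+_; +[1+_]; -[1+_])
import Data.Integer.Properties as ℤ
open import Data.Rational.Base as ℚ using (ℚ; mkℚ; 0ℚ; 1ℚ)
import Data.Rational.Properties as ℚ
open import Data.Rational.Solver using (module +-*-Solver)
import Data.Rational.Unnormalised.Base as ℚᵘ
import Data.Rational.Unnormalised.Properties as ℚᵘ
open import Data.Empty using (⊥-elim)
open import Data.Fin.Base using (Fin; zero)
open import Data.Fin.Properties using (_≟_)
open import Data.List.Base using (List; []; _∷_; _++_; _∷ʳ_; length; map; filter; deduplicate; allFin)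
open import Data.List.Properties using (length-++; length-map; map-++)
open import Data.List.Membership.Propositional using (_∈_; _∉_)
open import Data.List.Membership.Propositional.Properties
  using (∈-∃++; ∈-++⁺ˡ; ∈-++⁺ʳ; ∈-++⁻; ∈-map⁺; ∈-map⁻; ∈-allFin; ∈-filter⁺; ∈-filter⁻; ∈-deduplicate⁺; ∈-deduplicate⁻)
import Data.List.Membership.DecPropositional as DecMembership
import Data.List.Relation.Binary.Permutation.Propositional.Properties as Perm
open import Data.List.Relation.Binary.Subset.Propositional using (_⊆_)
open import Data.List.Relation.Unary.All as All using (All; []; _∷_)
import Data.List.Relation.Unary.All.Properties as All
open import Data.List.Relation.Unary.AllPairs using ([]; _∷_)
open import Data.List.Relation.Unary.Any using (here; there)
open import Data.List.Relation.Unary.Linked using (Linked; [-]; _∷_)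
open import Data.List.Relation.Unary.Unique.Propositional using (Unique)
import Data.List.Relation.Unary.Unique.Propositional.Properties as Unique
import Data.List.Relation.Unary.Unique.DecPropositional.Properties as UniqueDec
open import Data.Product.Base using (∃-syntax; _×_; _,_; proj₁; proj₂)
open import Data.Sum.Base using (_⊎_; inj₁; inj₂)
open import Data.Vec.Base using ([]; _∷_)
open import Function.Base using (id; _∘_)
open import Relation.Binary.PropositionalEquality
open import Relation.Nullary using (¬_; Dec; yes; no; ¬?)
open import Defs

-- The number π²/6

-- The squares in c_k come from a cancellation. Let n be one less than the number of vertices left
-- when phase i ≥ 3 ends. Summation by parts gives n the coefficient (i-1)/(i-2) - i/(i-1) =
-- 1/((i-2)(i-1)). Only cycles with at most i-1 edges remain then, so n ≤ (i-2)/(i-1) OPT, and the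
-- product is at most OPT/(i-1)². Only finitely many phases contribute, so c_k is rational and the
-- whole graph argument stays in ℚ. π enters only through the two inequalities on c_k. As reals are
-- Cauchy sequences and π is the Leibniz series, these become inequalities between partial sums,
-- valid from an explicit index on. Hence no limit is evaluated: an exact identity for the Nth
-- partial sum is proved by induction, and every error is bounded by a multiple of 1/(K+1) once N ≥
-- (K+1)².

module _ where
  open import Data.Rational.Base
  open import Data.Rational.Properties
  open +-*-Solver

  -- Naturals and unit fractions as rationals

  ι : ℕ → ℚ
  ι n = + n / 1

  inv : ℕ → ℚ
  inv n = + 1 / suc n

  ι-ᵘ : ∀ n → toℚᵘ (ι n) ℚᵘ.≃ ℚᵘ.mkℚᵘ (+ n) 0
  ι-ᵘ n = toℚᵘ-fromℚᵘ (ℚᵘ.mkℚᵘ (+ n) 0)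

  inv-ᵘ : ∀ n → toℚᵘ (inv n) ℚᵘ.≃ ℚᵘ.mkℚᵘ (+ 1) n
  inv-ᵘ n = toℚᵘ-fromℚᵘ (ℚᵘ.mkℚᵘ (+ 1) n)

  ι-+ : ∀ m n → ι (m ℕ.+ n) ≡ ι m + ι n
  ι-+ m n = toℚᵘ-injective (begin
    toℚᵘ (ι (m ℕ.+ n))                       ≈⟨ ι-ᵘ (m ℕ.+ n) ⟩
    ℚᵘ.mkℚᵘ (+ (m ℕ.+ n)) 0                   ≈⟨ ℚᵘ.*≡* (cong (ℤ._* + 1) (cong₂ ℤ._+_ (sym (ℤ.*-identityʳ (+ m))) (sym (ℤ.*-identityʳ (+ n))))) ⟩
    ℚᵘ.mkℚᵘ (+ m) 0 ℚᵘ.+ ℚᵘ.mkℚᵘ (+ n) 0     ≈⟨ ℚᵘ.+-cong (ι-ᵘ m) (ι-ᵘ n) ⟨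
    toℚᵘ (ι m) ℚᵘ.+ toℚᵘ (ι n)               ≈⟨ toℚᵘ-homo-+ (ι m) (ι n) ⟨
    toℚᵘ (ι m + ι n)                         ∎)
    where open ℚᵘ.≃-Reasoning

  ι-* : ∀ m n → ι (m ℕ.* n) ≡ ι m * ι n
  ι-* m n = toℚᵘ-injective (begin
    toℚᵘ (ι (m ℕ.* n))                       ≈⟨ ι-ᵘ (m ℕ.* n) ⟩
    ℚᵘ.mkℚᵘ (+ (m ℕ.* n)) 0                   ≈⟨ ℚᵘ.*≡* (cong (ℤ._* + 1) (ℤ.pos-* m n)) ⟩
    ℚᵘ.mkℚᵘ (+ m) 0 ℚᵘ.* ℚᵘ.mkℚᵘ (+ n) 0     ≈⟨ ℚᵘ.*-cong (ι-ᵘ m) (ι-ᵘ n) ⟨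
    toℚᵘ (ι m) ℚᵘ.* toℚᵘ (ι n)               ≈⟨ toℚᵘ-homo-* (ι m) (ι n) ⟨
    toℚᵘ (ι m * ι n)                         ∎)
    where open ℚᵘ.≃-Reasoning

  ι-mono : ∀ {m n} → m ℕ.≤ n → ι m ≤ ι n
  ι-mono {m} {n} m≤n = toℚᵘ-cancel-≤ (begin
    toℚᵘ (ι m)       ≃⟨ ι-ᵘ m ⟩
    ℚᵘ.mkℚᵘ (+ m) 0  ≤⟨ ℚᵘ.*≤* (ℤ.*-monoʳ-≤-nonNeg (+ 1) (ℤ.+≤+ m≤n)) ⟩
    ℚᵘ.mkℚᵘ (+ n) 0  ≃⟨ ι-ᵘ n ⟨
    toℚᵘ (ι n)       ∎)
    where open ℚᵘ.≤-Reasoning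

  ι*inv : ∀ n → ι (suc n) * inv n ≡ 1ℚ
  ι*inv n = toℚᵘ-injective (begin
    toℚᵘ (ι (suc n) * inv n)                       ≈⟨ toℚᵘ-homo-* (ι (suc n)) (inv n) ⟩
    toℚᵘ (ι (suc n)) ℚᵘ.* toℚᵘ (inv n)             ≈⟨ ℚᵘ.*-cong (ι-ᵘ (suc n)) (inv-ᵘ n) ⟩
    ℚᵘ.mkℚᵘ (+ suc n) 0 ℚᵘ.* ℚᵘ.mkℚᵘ (+ 1) n       ≈⟨ ℚᵘ.*≡* (trans (ℤ.*-identityʳ (+ suc n ℤ.* + 1)) (trans (ℤ.*-identityʳ _) (sym (trans (ℤ.*-identityˡ (+ suc (n ℕ.+ 0))) (cong (λ m → + suc m) (ℕ.+-identityʳ n)))))) ⟩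
    toℚᵘ 1ℚ                                        ∎)
    where open ℚᵘ.≃-Reasoning

  inv-antitone : ∀ {m n} → m ℕ.≤ n → inv n ≤ inv m
  inv-antitone {m} {n} m≤n = toℚᵘ-cancel-≤ (begin
    toℚᵘ (inv n)     ≃⟨ inv-ᵘ n ⟩
    ℚᵘ.mkℚᵘ (+ 1) n  ≤⟨ ℚᵘ.*≤* (ℤ.+≤+ (ℕ.+-monoˡ-≤ 0 (s≤s m≤n))) ⟩
    ℚᵘ.mkℚᵘ (+ 1) m  ≃⟨ inv-ᵘ m ⟨
    toℚᵘ (inv m)     ∎)
    where open ℚᵘ.≤-Reasoning

  inv-nonNeg : ∀ n → NonNegative (inv n)
  inv-nonNeg n = normalize-nonNeg 1 (suc n)

  ι-nonNeg : ∀ n → NonNegative (ι n)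
  ι-nonNeg n = normalize-nonNeg n 1

  0≤inv : ∀ n → 0ℚ ≤ inv n
  0≤inv n = nonNegative⁻¹ (inv n) {{inv-nonNeg n}}

  inv-archimedean : ∀ ε → 0ℚ < ε → ∃[ K ] inv K ≤ ε
  inv-archimedean ε@(mkℚ +[1+ p ] d c) _ = d , toℚᵘ-cancel-≤ (begin
    toℚᵘ (inv d)        ≃⟨ inv-ᵘ d ⟩
    ℚᵘ.mkℚᵘ (+ 1) d     ≤⟨ ℚᵘ.*≤* (ℤ.+≤+ (ℕ.*-monoˡ-≤ (suc d) (s≤s (z≤n {p})))) ⟩
    ℚᵘ.mkℚᵘ +[1+ p ] d  ∎)
    where open ℚᵘ.≤-Reasoning
  inv-archimedean (mkℚ (+ zero) d c) (*<* (ℤ.+<+ ()))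
  inv-archimedean (mkℚ -[1+ _ ] d c) (*<* ())

  -- Finite sums and signs

  sum : ℕ → (ℕ → ℚ) → ℚ
  sum zero    f = 0ℚ
  sum (suc n) f = sum n f + f n

  sum-cong : ∀ n {f g} → (∀ {i} → i ℕ.< n → f i ≡ g i) → sum n f ≡ sum n g
  sum-cong zero    eq = refl
  sum-cong (suc n) eq = cong₂ _+_ (sum-cong n (λ i<n → eq (ℕ.m<n⇒m<1+n i<n))) (eq ℕ.≤-refl)

  sum-mono : ∀ n {f g} → (∀ {i} → i ℕ.< n → f i ≤ g i) → sum n f ≤ sum n g
  sum-mono zero    le = ≤-refl
  sum-mono (suc n) le = +-mono-≤ (sum-mono n (λ i<n → le (ℕ.m<n⇒m<1+n i<n))) (le ℕ.≤-refl)

  sum-+ : ∀ n f g → sum n (λ i → f i + g i) ≡ sum n f + sum n g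
  sum-+ zero    f g = refl
  sum-+ (suc n) f g = trans (cong (_+ (f n + g n)) (sum-+ n f g))
    (solve 4 (λ a b c d → (a :+ b) :+ (c :+ d) := (a :+ c) :+ (b :+ d)) refl (sum n f) (sum n g) (f n) (g n))

  sum-* : ∀ n c f → sum n (λ i → c * f i) ≡ c * sum n f
  sum-* zero    c f = sym (*-zeroʳ c)
  sum-* (suc n) c f = trans (cong (_+ c * f n) (sum-* n c f)) (sym (*-distribˡ-+ c (sum n f) (f n)))

  sum-suc : ∀ n f → sum (suc n) f ≡ f 0 + sum n (λ i → f (suc i))
  sum-suc zero    f = +-comm 0ℚ (f 0)
  sum-suc (suc n) f = trans (cong (_+ f (suc n)) (sum-suc n f)) (+-assoc (f 0) _ (f (suc n)))

  sum-reverse : ∀ n f → sum n (λ i → f (n ℕ.∸ suc i)) ≡ sum n f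
  sum-reverse zero    f = refl
  sum-reverse (suc n) f = trans (sum-suc n (λ i → f (n ℕ.∸ i)))
    (trans (cong (_+_ (f n)) (sum-reverse n f)) (+-comm (f n) (sum n f)))

  sum-split : ∀ m n f → sum (m ℕ.+ n) f ≡ sum m f + sum n (λ i → f (m ℕ.+ i))
  sum-split m zero    f = trans (cong (λ k → sum k f) (ℕ.+-identityʳ m)) (sym (+-identityʳ (sum m f)))
  sum-split m (suc n) f = trans (cong (λ k → sum k f) (ℕ.+-suc m n))
    (trans (cong (_+ f (m ℕ.+ n)) (sum-split m n f)) (+-assoc (sum m f) _ _))

  ∣sum∣ : ∀ n f → ∣ sum n f ∣ ≤ sum n (λ i → ∣ f i ∣)
  ∣sum∣ zero    f = ≤-refl
  ∣sum∣ (suc n) f = ≤-trans (∣p+q∣≤∣p∣+∣q∣ (sum n f) (f n)) (+-monoˡ-≤ ∣ f n ∣ (∣sum∣ n f))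

  p≤∣p∣ : ∀ p → p ≤ ∣ p ∣
  p≤∣p∣ p with ≤-total 0ℚ p
  ... | inj₁ 0≤p = ≤-reflexive (sym (0≤p⇒∣p∣≡p 0≤p))
  ... | inj₂ p≤0 = ≤-trans p≤0 (0≤∣p∣ p)

  alternating-+ : ∀ m n → alternating (m ℕ.+ n) ≡ alternating m * alternating n
  alternating-+ zero    n = sym (*-identityˡ (alternating n))
  alternating-+ (suc m) n = trans (cong -_ (alternating-+ m n)) (neg-distribˡ-* (alternating m) (alternating n))

  alternating² : ∀ n → alternating n * alternating n ≡ 1ℚ
  alternating² zero    = refl
  alternating² (suc n) = trans (solve 1 (λ a → (:- a) :* (:- a) := a :* a) refl (alternating n)) (alternating² n)

  ∣alternating∣ : ∀ n → ∣ alternating n ∣ ≡ 1ℚ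
  ∣alternating∣ zero    = refl
  ∣alternating∣ (suc n) = trans (∣-p∣≡∣p∣ (alternating n)) (∣alternating∣ n)

  -- Alternating harmonic sums

  harmonicTerm : ℕ → ℚ
  harmonicTerm d = - (alternating d * inv d)

  -- Since `inv` is shifted by one, this is Σ (-1)^d / d over 1 ≤ d ≤ m.
  altHarmonic : ℕ → ℚ
  altHarmonic m = sum m harmonicTerm

  harmonicTail : ℕ → ℕ → ℚ
  harmonicTail m zero    = 0ℚ
  harmonicTail m (suc j) = inv m - harmonicTail (suc m) j

  harmonicTail-bounds : ∀ m j → 0ℚ ≤ harmonicTail m j × harmonicTail m j ≤ inv m
  harmonicTail-bounds m zero    = ≤-refl , 0≤inv m
  harmonicTail-bounds m (suc j) with harmonicTail-bounds (suc m) j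
  ... | lo , hi =
      ≤-trans (≤-reflexive (sym (+-inverseʳ (inv m))))
        (+-monoʳ-≤ (inv m) (neg-antimono-≤ (≤-trans hi (inv-antitone (ℕ.n≤1+n m)))))
    , ≤-trans (+-monoʳ-≤ (inv m) (neg-antimono-≤ lo)) (≤-reflexive (+-identityʳ (inv m)))

  altHarmonic-tail : ∀ m j → altHarmonic (m ℕ.+ j) ≡ altHarmonic m - alternating m * harmonicTail m j
  altHarmonic-tail m zero    = trans (cong altHarmonic (ℕ.+-identityʳ m))
    (solve 2 (λ l s → l := l :- s :* con 0ℚ) refl (altHarmonic m) (alternating m))
  altHarmonic-tail m (suc j) = trans (cong altHarmonic (ℕ.+-suc m j)) (trans (altHarmonic-tail (suc m) j)
    (solve 4 (λ l s a t → (l :+ :- (s :* a)) :- (:- s) :* t := l :- s :* (a :- t)) refl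
      (altHarmonic m) (alternating m) (inv m) (harmonicTail (suc m) j)))

  altHarmonic-close : ∀ m j → ∣ altHarmonic (m ℕ.+ j) - altHarmonic m ∣ ≤ inv m
  altHarmonic-close m j = let open ≤-Reasoning in begin
    ∣ altHarmonic (m ℕ.+ j) - altHarmonic m ∣                     ≡⟨ cong (λ q → ∣ q - altHarmonic m ∣) (altHarmonic-tail m j) ⟩
    ∣ altHarmonic m - alternating m * harmonicTail m j - altHarmonic m ∣ ≡⟨ cong ∣_∣ (solve 2 (λ l t → l :- t :- l := :- t) refl (altHarmonic m) (alternating m * harmonicTail m j)) ⟩
    ∣ - (alternating m * harmonicTail m j) ∣         ≡⟨ ∣-p∣≡∣p∣ (alternating m * harmonicTail m j) ⟩
    ∣ alternating m * harmonicTail m j ∣             ≡⟨ ∣p*q∣≡∣p∣*∣q∣ (alternating m) (harmonicTail m j) ⟩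
    ∣ alternating m ∣ * ∣ harmonicTail m j ∣         ≡⟨ cong₂ _*_ (∣alternating∣ m) (0≤p⇒∣p∣≡p (proj₁ (harmonicTail-bounds m j))) ⟩
    1ℚ * harmonicTail m j                            ≡⟨ *-identityˡ (harmonicTail m j) ⟩
    harmonicTail m j                                 ≤⟨ proj₂ (harmonicTail-bounds m j) ⟩
    inv m                                     ∎

  -- altBlock N n = Σ (-1)^d / d over N - n ≤ d ≤ N + n, for n < N.
  altBlock : ℕ → ℕ → ℚ
  altBlock N n = altHarmonic (N ℕ.+ n) - altHarmonic (N ℕ.∸ suc n)

  -- The square of the Leibniz series

  oddSquares : ℕ → ℚ
  oddSquares N = sum N (λ n → oddRecip n * oddRecip n)

  defect : ℕ → ℚ
  defect N = (leibniz N * leibniz N + leibniz N * leibniz N) - oddSquares N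

  -- With Q = P + X, the last denominator P + Q is 2P + X as well as 2Q - X. Multiplying a c by the
  -- former gives 2c + a, and b c by the latter gives 2c - b. The intended values are P = N - n, Q =
  -- N + n + 1, X = 2n + 1, for which P + Q = 2N + 1 does not depend on n.
  partialFraction : ∀ {P X a b c d} → P * a ≡ 1ℚ → (P + X) * b ≡ 1ℚ → X * c ≡ 1ℚ → (P + (P + X)) * d ≡ 1ℚ →
    (a + b) * c ≡ d * (ι 4 * c + (a - b))
  partialFraction {P} {X} {a} {b} {c} {d} Pa Qb Xc Yd = begin
    (a + b) * c                                    ≡⟨ *-identityʳ _ ⟨
    (a + b) * c * 1ℚ                               ≡⟨ cong ((a + b) * c *_) Yd ⟨
    (a + b) * c * ((P + (P + X)) * d)
      ≡⟨ solve 6 (λ P X a b c d → (a :+ b) :* c :* ((P :+ (P :+ X)) :* d) :=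
           d :* ((con (ι 2) :* (P :* a) :+ con (ι 2) :* ((P :+ X) :* b)) :* c :+ (X :* c) :* (a :- b))) refl P X a b c d ⟩
    d * ((ι 2 * (P * a) + ι 2 * ((P + X) * b)) * c + (X * c) * (a - b))
      ≡⟨ cong₂ (λ u v → d * ((ι 2 * u + ι 2 * v) * c + (X * c) * (a - b))) Pa Qb ⟩
    d * ((ι 2 * 1ℚ + ι 2 * 1ℚ) * c + (X * c) * (a - b))
      ≡⟨ cong (λ u → d * ((ι 2 * 1ℚ + ι 2 * 1ℚ) * c + u * (a - b))) Xc ⟩
    d * ((ι 2 * 1ℚ + ι 2 * 1ℚ) * c + 1ℚ * (a - b))  ≡⟨ cong (λ u → d * (ι 4 * c + u)) (*-identityˡ (a - b)) ⟩
    d * (ι 4 * c + (a - b))                        ∎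
    where open ≡-Reasoning

  partialFraction₂ : ∀ {P X a c d} → P * a ≡ 1ℚ → X * c ≡ 1ℚ → (P + P + X) * d ≡ 1ℚ →
    a * c ≡ d * (ι 2 * c + a)
  partialFraction₂ {P} {X} {a} {c} {d} Pa Xc Yd = begin
    a * c                          ≡⟨ *-identityʳ _ ⟨
    a * c * 1ℚ                     ≡⟨ cong (a * c *_) Yd ⟨
    a * c * ((P + P + X) * d)
      ≡⟨ solve 5 (λ P X a c d → a :* c :* ((P :+ P :+ X) :* d) :=
           d :* (con (ι 2) :* (P :* a) :* c :+ (X :* c) :* a)) refl P X a c d ⟩
    d * (ι 2 * (P * a) * c + (X * c) * a) ≡⟨ cong₂ (λ u v → d * (ι 2 * u * c + v * a)) Pa Xc ⟩
    d * (ι 2 * 1ℚ * c + 1ℚ * a)    ≡⟨ cong (λ u → d * (ι 2 * c + u)) (*-identityˡ a) ⟩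
    d * (ι 2 * c + a)              ∎
    where open ≡-Reasoning

  ι≡⇒*inv : ∀ {q k m} → q ≡ ι m → m ≡ suc k → q * inv k ≡ 1ℚ
  ι≡⇒*inv {k = k} refl refl = ι*inv k

  private
    index-N+n : ∀ n m → suc m ℕ.+ suc (2 ℕ.* n) ≡ suc (suc (n ℕ.+ m) ℕ.+ n)
    index-N+n = solveℕ

    index-2N+1 : ∀ n m → suc m ℕ.+ (suc m ℕ.+ suc (2 ℕ.* n)) ≡ suc (2 ℕ.* suc (n ℕ.+ m))
    index-2N+1 = solveℕ

  -- From N to N + 1 the block gains the entry at N + n + 1 and loses the one at N - n. These
  -- indices have opposite parity, so both changes have the same sign, and `partialFraction` applies
  -- to 1/(N - n) + 1/(N + n + 1).
  altBlock-step : ∀ n m → let N = suc (n ℕ.+ m) in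
    - (altBlock (suc N) n * oddRecip n) ≡
    - (altBlock N n * oddRecip n) +
      oddRecip N * (ι 4 * (alternating N * (alternating n * oddRecip n))
                    + (harmonicTerm (N ℕ.∸ suc n) + harmonicTerm (N ℕ.+ n)))
  altBlock-step n m = begin
    - (((altHarmonic (N ℕ.+ n) + harmonicTerm (N ℕ.+ n)) - altHarmonic (suc N ℕ.∸ suc n)) * c)
      ≡⟨ cong (λ i → - (((altHarmonic (N ℕ.+ n) + harmonicTerm (N ℕ.+ n)) - altHarmonic i) * c)) N∸n ⟩
    - (((e₁ + harmonicTerm (N ℕ.+ n)) - (e₀ + - (w * a))) * c)
      ≡⟨ cong (λ h → - (((e₁ + h) - (e₀ + - (w * a))) * c)) h₁ ⟩
    - (((e₁ + w * b) - (e₀ + - (w * a))) * c)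
      ≡⟨ solve 6 (λ e₁ e₀ w a b c → :- (((e₁ :+ w :* b) :- (e₀ :+ :- (w :* a))) :* c) :=
           :- ((e₁ :- e₀) :* c) :- w :* ((a :+ b) :* c)) refl e₁ e₀ w a b c ⟩
    - ((e₁ - e₀) * c) - w * ((a + b) * c)
      ≡⟨ cong (λ q → - ((e₁ - e₀) * c) - w * q)
           (partialFraction {ι (suc m)} {ι (suc (2 ℕ.* n))} {a} {b} {c} {d} (ι*inv m)
             (ι≡⇒*inv (sym (ι-+ (suc m) (suc (2 ℕ.* n)))) (index-N+n n m))
             (ι*inv (2 ℕ.* n))
             (ι≡⇒*inv (trans (cong (_+_ (ι (suc m))) (sym (ι-+ (suc m) (suc (2 ℕ.* n)))))
               (sym (ι-+ (suc m) _))) (index-2N+1 n m))) ⟩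
    - ((e₁ - e₀) * c) - w * (d * (ι 4 * c + (a - b)))
      ≡⟨ solve 7 (λ e₁ e₀ w a b c d → :- ((e₁ :- e₀) :* c) :- w :* (d :* (con (ι 4) :* c :+ (a :- b))) :=
           :- ((e₁ :- e₀) :* c) :+ d :* (con (ι 4) :* ((:- w) :* c) :+ (:- (w :* a) :+ w :* b))) refl e₁ e₀ w a b c d ⟩
    - ((e₁ - e₀) * c) + d * (ι 4 * ((- w) * c) + (- (w * a) + w * b))
      ≡⟨ cong₂ (λ u v → - ((e₁ - e₀) * c) + d * (ι 4 * u + (- (w * a) + v)))
           (trans (cong (_* c) (sym st)) (*-assoc s t c)) (sym h₁) ⟩
    - ((e₁ - e₀) * c) + d * (ι 4 * (s * (t * c)) + (harmonicTerm m + harmonicTerm (N ℕ.+ n)))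
      ≡⟨ cong (λ i → - ((e₁ - altHarmonic i) * c) + d * (ι 4 * (s * (t * c)) + (harmonicTerm i + harmonicTerm (N ℕ.+ n)))) (sym (ℕ.m+n∸m≡n n m)) ⟩
    - ((e₁ - altHarmonic (N ℕ.∸ suc n)) * c) +
      d * (ι 4 * (s * (t * c)) + (harmonicTerm (N ℕ.∸ suc n) + harmonicTerm (N ℕ.+ n))) ∎
    where
    open ≡-Reasoning
    N = suc (n ℕ.+ m)
    a = inv m
    b = inv (N ℕ.+ n)
    c = oddRecip n
    d = oddRecip N
    s = alternating N
    t = alternating n
    w = alternating m
    e₁ = altHarmonic (N ℕ.+ n)
    e₀ = altHarmonic m
    N∸n : suc (n ℕ.+ m) ℕ.∸ n ≡ suc m
    N∸n = trans (cong (ℕ._∸ n) (sym (ℕ.+-suc n m))) (ℕ.m+n∸m≡n n (suc m))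
    -- N + n = 2n + m + 1, which has the parity opposite to that of m.
    st : s * t ≡ - w
    st = begin
      - alternating (n ℕ.+ m) * t ≡⟨ cong (λ q → - q * t) (alternating-+ n m) ⟩
      - (t * w) * t               ≡⟨ solve 2 (λ t w → :- (t :* w) :* t := :- ((t :* t) :* w)) refl t w ⟩
      - ((t * t) * w)             ≡⟨ cong (λ q → - (q * w)) (alternating² n) ⟩
      - (1ℚ * w)                  ≡⟨ cong -_ (*-identityˡ w) ⟩
      - w                         ∎
    h₁ : harmonicTerm (N ℕ.+ n) ≡ w * b
    h₁ = trans (cong (λ q → - (q * b)) (trans (alternating-+ N n) st))
      (solve 2 (λ w b → :- ((:- w) :* b) := w :* b) refl w b)

  leibniz-sum : ∀ N → leibniz N ≡ sum N (λ n → alternating n * oddRecip n)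
  leibniz-sum zero    = refl
  leibniz-sum (suc N) = cong (_+ alternating N * oddRecip N) (leibniz-sum N)

  -- Both sides grow by 4 (-1)^N leibniz N / (2N+1) + 1/(2N+1)² from N to N + 1: by
  -- partial fractions the increments of the blocks reassemble into leibniz N and
  -- an alternating harmonic sum, and the latter cancels against the new block.
  defect-sum : ∀ N → defect N ≡ sum N (λ n → - (altBlock N n * oddRecip n))
  defect-sum zero    = refl
  defect-sum (suc N) = sym (begin
    sum N (λ n → - (altBlock (suc N) n * oddRecip n)) + - (altBlock (suc N) N * d)
      ≡⟨ cong (_+ - (altBlock (suc N) N * d)) (sum-cong N λ {n} n<N → recurrence n n<N) ⟩
    sum N (λ n → - (altBlock N n * oddRecip n) + d * (ι 4 * (s * (alternating n * oddRecip n)) + (f n + g n))) + - (altBlock (suc N) N * d)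
      ≡⟨ cong₂ _+_ sums last ⟩
    (defect N + d * (ι 4 * (s * l) + e)) + - (((e + - d) - 0ℚ) * d)
      -- One factor 1 is kept explicit so that the next step can turn it into s * s, which the
      -- square of l + s d requires.
      ≡⟨ solve 5 (λ l o s d e →
           (((l :* l :+ l :* l) :- o) :+ d :* (con (ι 4) :* (s :* l) :+ e)) :+ :- (((e :+ :- d) :- con 0ℚ) :* d) :=
           ((l :* l :+ l :* l) :- o) :+ con (ι 4) :* (d :* (s :* l)) :+ con (ι 2) :* (con 1ℚ :* (d :* d)) :- d :* d) refl l o s d e ⟩
    ((l * l + l * l) - o) + ι 4 * (d * (s * l)) + ι 2 * (1ℚ * (d * d)) - d * d
      ≡⟨ cong (λ q → ((l * l + l * l) - o) + ι 4 * (d * (s * l)) + ι 2 * (q * (d * d)) - d * d) (sym (alternating² N)) ⟩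
    ((l * l + l * l) - o) + ι 4 * (d * (s * l)) + ι 2 * ((s * s) * (d * d)) - d * d
      ≡⟨ solve 4 (λ l o s d →
           ((l :* l :+ l :* l) :- o) :+ con (ι 4) :* (d :* (s :* l)) :+ con (ι 2) :* ((s :* s) :* (d :* d)) :- d :* d :=
           ((l :+ s :* d) :* (l :+ s :* d) :+ (l :+ s :* d) :* (l :+ s :* d)) :- (o :+ d :* d)) refl l o s d ⟩
    defect (suc N) ∎)
    where
    open ≡-Reasoning
    d = oddRecip N
    s = alternating N
    l = leibniz N
    o = oddSquares N
    e = altHarmonic (N ℕ.+ N)
    f g : ℕ → ℚ
    f n = harmonicTerm (N ℕ.∸ suc n)
    g n = harmonicTerm (N ℕ.+ n)
    recurrence : ∀ n → n ℕ.< N → - (altBlock (suc N) n * oddRecip n) ≡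
      - (altBlock N n * oddRecip n) + d * (ι 4 * (s * (alternating n * oddRecip n)) + (f n + g n))
    recurrence n n<N with ℕ.m≤n⇒∃[o]m+o≡n n<N
    ... | m , refl = altBlock-step n m
    -- Read backwards, f runs through the terms 0 to N - 1, and g continues with N to 2N - 1.
    fg : sum N (λ n → f n + g n) ≡ e
    fg = trans (sum-+ N f g) (trans (cong (_+ sum N g) (sum-reverse N harmonicTerm)) (sym (sum-split N N harmonicTerm)))
    sums : sum N (λ n → - (altBlock N n * oddRecip n) + d * (ι 4 * (s * (alternating n * oddRecip n)) + (f n + g n)))
      ≡ defect N + d * (ι 4 * (s * l) + e)
    sums = begin
      sum N (λ n → - (altBlock N n * oddRecip n) + d * (ι 4 * (s * (alternating n * oddRecip n)) + (f n + g n)))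
        ≡⟨ sum-+ N _ _ ⟩
      sum N (λ n → - (altBlock N n * oddRecip n)) + sum N (λ n → d * (ι 4 * (s * (alternating n * oddRecip n)) + (f n + g n)))
        ≡⟨ cong₂ _+_ (sym (defect-sum N)) (sum-* N d _) ⟩
      defect N + d * sum N (λ n → ι 4 * (s * (alternating n * oddRecip n)) + (f n + g n))
        ≡⟨ cong (λ q → defect N + d * q) (begin
          sum N (λ n → ι 4 * (s * (alternating n * oddRecip n)) + (f n + g n))
            ≡⟨ sum-+ N _ _ ⟩
          sum N (λ n → ι 4 * (s * (alternating n * oddRecip n))) + sum N (λ n → f n + g n)
            ≡⟨ cong₂ _+_ (trans (sum-* N (ι 4) _) (cong (ι 4 *_) (trans (sum-* N s _) (cong (s *_) (sym (leibniz-sum N)))))) fg ⟩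
          ι 4 * (s * l) + e ∎) ⟩
      defect N + d * (ι 4 * (s * l) + e) ∎
    -- The new block starts at the very first term, so it is the sum `e` extended by the term
    -- -1/(2N+1).
    last : - (altBlock (suc N) N * d) ≡ - (((e + - d) - 0ℚ) * d)
    last = cong₂ (λ h i → - (((e + h) - altHarmonic i) * d))
      (cong -_ (trans (cong₂ _*_ (trans (alternating-+ N N) (alternating² N))
                         (cong (λ i → inv (N ℕ.+ i)) (sym (ℕ.+-identityʳ N)))) (*-identityˡ d)))
      (ℕ.n∸n≡0 N)

  *-mono-nonNeg : ∀ {p q r s} → 0ℚ ≤ r → 0ℚ ≤ q → p ≤ q → r ≤ s → p * r ≤ q * s
  *-mono-nonNeg {p} {q} {r} {s} 0≤r 0≤q p≤q r≤s = ≤-trans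
    (*-monoʳ-≤-nonNeg r {{nonNegative 0≤r}} p≤q) (*-monoˡ-≤-nonNeg q {{nonNegative 0≤q}} r≤s)

  inv-unique : ∀ n {x} → ι (suc n) * x ≡ 1ℚ → x ≡ inv n
  inv-unique n {x} eq = begin
    x                          ≡⟨ *-identityˡ x ⟨
    1ℚ * x                     ≡⟨ cong (_* x) (ι*inv n) ⟨
    ι (suc n) * inv n * x      ≡⟨ solve 3 (λ p a x → p :* a :* x := (p :* x) :* a) refl (ι (suc n)) (inv n) x ⟩
    ι (suc n) * x * inv n      ≡⟨ cong (_* inv n) eq ⟩
    1ℚ * inv n                 ≡⟨ *-identityˡ (inv n) ⟩
    inv n                      ∎
    where open ≡-Reasoning

  inv-* : ∀ m n → inv m * inv n ≡ inv (n ℕ.+ m ℕ.* suc n)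
  inv-* m n = inv-unique (n ℕ.+ m ℕ.* suc n) (begin
    ι (suc m ℕ.* suc n) * (inv m * inv n)       ≡⟨ cong (_* (inv m * inv n)) (ι-* (suc m) (suc n)) ⟩
    ι (suc m) * ι (suc n) * (inv m * inv n)
      ≡⟨ solve 4 (λ p q a b → p :* q :* (a :* b) := (p :* a) :* (q :* b)) refl (ι (suc m)) (ι (suc n)) (inv m) (inv n) ⟩
    ι (suc m) * inv m * (ι (suc n) * inv n)     ≡⟨ cong₂ _*_ (ι*inv m) (ι*inv n) ⟩
    1ℚ                                          ∎)
    where open ≡-Reasoning

  inv-telescope : ∀ n → inv n ≡ inv (suc n) + inv n * inv (suc n)
  inv-telescope n = begin
    a                    ≡⟨ *-identityʳ a ⟨
    a * 1ℚ               ≡⟨ cong (a *_) (ι*inv (suc n)) ⟨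
    a * (ι (suc (suc n)) * b) ≡⟨ cong (λ q → a * (q * b)) (ι-+ 1 (suc n)) ⟩
    a * ((1ℚ + p) * b)   ≡⟨ solve 3 (λ p a b → a :* ((con 1ℚ :+ p) :* b) := (p :* a) :* b :+ a :* b) refl p a b ⟩
    p * a * b + a * b    ≡⟨ cong (λ q → q * b + a * b) (ι*inv n) ⟩
    1ℚ * b + a * b       ≡⟨ cong (_+ a * b) (*-identityˡ b) ⟩
    b + a * b            ∎
    where
    open ≡-Reasoning
    a = inv n
    b = inv (suc n)
    p = ι (suc n)

  sum-const : ∀ n c → sum n (λ _ → c) ≡ ι n * c
  sum-const zero    c = sym (*-zeroˡ c)
  sum-const (suc n) c = begin
    sum n (λ _ → c) + c ≡⟨ cong (_+ c) (sum-const n c) ⟩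
    ι n * c + c         ≡⟨ solve 2 (λ p c → p :* c :+ c := (con 1ℚ :+ p) :* c) refl (ι n) c ⟩
    (1ℚ + ι n) * c      ≡⟨ cong (_* c) (ι-+ 1 n) ⟨
    ι (suc n) * c       ∎
    where open ≡-Reasoning

  oddRecip≤inv : ∀ n → oddRecip n ≤ inv n
  oddRecip≤inv n = inv-antitone (ℕ.m≤m+n n (n ℕ.+ 0))

  -- Decay of the defect

  harmonic : ℕ → ℚ
  harmonic N = sum N inv

  -- A cutoff in place of the logarithm: the first K terms are at most 1, the others at most
  -- 1/(K+1). Divided by K + M, this is small as soon as K is large and K + M is at least of the
  -- order of K².
  harmonic-bound : ∀ K M → harmonic (K ℕ.+ M) ≤ ι K + ι M * inv K
  harmonic-bound K M = begin
    harmonic (K ℕ.+ M)                              ≡⟨ sum-split K M inv ⟩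
    sum K inv + sum M (λ i → inv (K ℕ.+ i))
      ≤⟨ +-mono-≤ (sum-mono K (λ {i} _ → inv-antitone {0} {i} z≤n)) (sum-mono M (λ {i} _ → inv-antitone (ℕ.m≤m+n K i))) ⟩
    sum K (λ _ → 1ℚ) + sum M (λ _ → inv K)          ≡⟨ cong₂ _+_ (trans (sum-const K 1ℚ) (*-identityʳ (ι K))) (sum-const M (inv K)) ⟩
    ι K + ι M * inv K                               ∎
    where open ≤-Reasoning

  ∣altBlock∣≤inv : ∀ {N n} → n ℕ.< N → ∣ altBlock N n ∣ ≤ inv (N ℕ.∸ suc n)
  ∣altBlock∣≤inv {N} {n} n<N with ℕ.m≤n⇒∃[o]m+o≡n n<N
  ... | m , refl = subst (λ i → ∣ altHarmonic i - altHarmonic (N ℕ.∸ suc n) ∣ ≤ inv (N ℕ.∸ suc n))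
    (trans (cong (ℕ._+ suc (n ℕ.+ n)) (ℕ.m+n∸m≡n n m)) (index n m)) (altHarmonic-close (N ℕ.∸ suc n) (suc (n ℕ.+ n)))
    where
    index : ∀ n m → m ℕ.+ suc (n ℕ.+ n) ≡ suc (n ℕ.+ m) ℕ.+ n
    index = solveℕ

  -- Because 2(N - n) + (2n + 1) = 2N + 1 is independent of n, the convolution of 1/(N - n) with
  -- 1/(2n + 1) separates into two harmonic sums.
  convolution-split : ∀ {N n} → n ℕ.< N →
    inv (N ℕ.∸ suc n) * oddRecip n ≡ oddRecip N * (ι 2 * oddRecip n + inv (N ℕ.∸ suc n))
  convolution-split {N} {n} n<N with ℕ.m≤n⇒∃[o]m+o≡n n<N
  ... | m , refl = subst (λ i → inv i * oddRecip n ≡ oddRecip N * (ι 2 * oddRecip n + inv i)) (sym (ℕ.m+n∸m≡n n m))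
    (partialFraction₂ {ι (suc m)} {ι (suc (2 ℕ.* n))} {inv m} {oddRecip n} {oddRecip N}
      (ι*inv m) (ι*inv (2 ℕ.* n))
      (ι≡⇒*inv (trans (cong (_+ ι (suc (2 ℕ.* n))) (sym (ι-+ (suc m) (suc m)))) (sym (ι-+ (suc m ℕ.+ suc m) _))) (index n m)))
    where
    index : ∀ n m → suc m ℕ.+ suc m ℕ.+ suc (2 ℕ.* n) ≡ suc (2 ℕ.* suc (n ℕ.+ m))
    index = solveℕ

  ∣defect∣≤harmonic : ∀ N → ∣ defect N ∣ ≤ oddRecip N * (ι 3 * harmonic N)
  ∣defect∣≤harmonic N = begin
    ∣ defect N ∣                                     ≡⟨ cong ∣_∣ (defect-sum N) ⟩
    ∣ sum N (λ n → - (altBlock N n * oddRecip n)) ∣         ≤⟨ ∣sum∣ N _ ⟩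
    sum N (λ n → ∣ - (altBlock N n * oddRecip n) ∣)
      ≤⟨ sum-mono N (λ {n} n<N → ≤-trans
           (≤-reflexive (trans (∣-p∣≡∣p∣ (altBlock N n * oddRecip n)) (trans (∣p*q∣≡∣p∣*∣q∣ (altBlock N n) (oddRecip n))
             (cong (∣ altBlock N n ∣ *_) (0≤p⇒∣p∣≡p (0≤inv (2 ℕ.* n)))))))
           (*-monoʳ-≤-nonNeg (oddRecip n) {{inv-nonNeg (2 ℕ.* n)}} (∣altBlock∣≤inv n<N))) ⟩
    sum N (λ n → inv (N ℕ.∸ suc n) * oddRecip n)     ≡⟨ sum-cong N convolution-split ⟩
    sum N (λ n → d * (ι 2 * oddRecip n + inv (N ℕ.∸ suc n))) ≡⟨ sum-* N d _ ⟩
    d * sum N (λ n → ι 2 * oddRecip n + inv (N ℕ.∸ suc n))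
      ≡⟨ cong (d *_) (trans (sum-+ N _ _) (cong₂ _+_ (sum-* N (ι 2) oddRecip) (sum-reverse N inv))) ⟩
    d * (ι 2 * sum N oddRecip + harmonic N)
      ≤⟨ *-monoˡ-≤-nonNeg d {{inv-nonNeg (2 ℕ.* N)}} (+-monoˡ-≤ (harmonic N)
           (*-monoˡ-≤-nonNeg (ι 2) (sum-mono N (λ {n} _ → oddRecip≤inv n)))) ⟩
    d * (ι 2 * harmonic N + harmonic N)
      ≡⟨ cong (d *_) (solve 1 (λ h → con (ι 2) :* h :+ h := con (ι 3) :* h) refl (harmonic N)) ⟩
    d * (ι 3 * harmonic N)                           ∎
    where
    open ≤-Reasoning
    d = oddRecip N

  -- Write N = K + M. After division by 2N + 1 both parts of the cutoff bound are at most 1/(K+1):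
  -- the K because N ≥ (K+1)², and M/(K+1) because M ≤ 2N + 1. The 6 is these two parts times the 3
  -- of `∣defect∣≤harmonic`.
  ∣defect∣-bound : ∀ K N → suc K ℕ.* suc K ℕ.≤ N → ∣ defect N ∣ ≤ ι 6 * inv K
  ∣defect∣-bound K N K²≤N with ℕ.m≤n⇒∃[o]m+o≡n (ℕ.≤-trans (ℕ.≤-trans (ℕ.n≤1+n K) (ℕ.m≤m*n (suc K) (suc K))) K²≤N)
  ... | M , refl = begin
    ∣ defect N ∣                          ≤⟨ ∣defect∣≤harmonic N ⟩
    d * (ι 3 * harmonic N)
      ≤⟨ *-monoˡ-≤-nonNeg d {{inv-nonNeg (2 ℕ.* N)}} (*-monoˡ-≤-nonNeg (ι 3) (harmonic-bound K M)) ⟩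
    d * (ι 3 * (ι K + ι M * inv K))
      ≡⟨ solve 4 (λ d k m i → d :* (con (ι 3) :* (k :+ m :* i)) := con (ι 3) :* (d :* k :+ d :* m :* i)) refl d (ι K) (ι M) (inv K) ⟩
    ι 3 * (d * ι K + d * ι M * inv K)
      ≤⟨ *-monoˡ-≤-nonNeg (ι 3) (+-mono-≤ dK (*-monoʳ-≤-nonNeg (inv K) {{inv-nonNeg K}} dM)) ⟩
    ι 3 * (inv K + 1ℚ * inv K)
      ≡⟨ solve 1 (λ i → con (ι 3) :* (i :+ con 1ℚ :* i) := con (ι 6) :* i) refl (inv K) ⟩
    ι 6 * inv K                           ∎
    where
    open ≤-Reasoning
    d = oddRecip N
    dM : d * ι M ≤ 1ℚ
    dM = begin
      d * ι M           ≤⟨ *-mono-nonNeg {d} {inv N} {ι M} (nonNegative⁻¹ (ι M) {{ι-nonNeg M}}) (0≤inv N) (oddRecip≤inv N) (ι-mono (ℕ.m≤n⇒m≤1+n (ℕ.m≤n+m M K))) ⟩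
      inv N * ι (suc N) ≡⟨ *-comm (inv N) _ ⟩
      ι (suc N) * inv N ≡⟨ ι*inv N ⟩
      1ℚ                ∎
    dK : d * ι K ≤ inv K
    dK = begin
      d * ι K             ≤⟨ *-mono-nonNeg {d} {inv N} {ι K} (nonNegative⁻¹ (ι K) {{ι-nonNeg K}}) (0≤inv N) (oddRecip≤inv N) (ι-mono (ℕ.n≤1+n K)) ⟩
      inv N * ι (suc K)   ≤⟨ *-monoʳ-≤-nonNeg (ι (suc K)) {{ι-nonNeg (suc K)}} (inv-antitone (ℕ.≤-trans (ℕ.n≤1+n _) K²≤N)) ⟩
      inv (K ℕ.+ K ℕ.* suc K) * ι (suc K) ≡⟨ cong (_* ι (suc K)) (sym (inv-* K K)) ⟩
      inv K * inv K * ι (suc K)           ≡⟨ solve 2 (λ i k → i :* i :* k := i :* (k :* i)) refl (inv K) (ι (suc K)) ⟩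
      inv K * (ι (suc K) * inv K)         ≡⟨ cong (inv K *_) (ι*inv K) ⟩
      inv K * 1ℚ                          ≡⟨ *-identityʳ (inv K) ⟩
      inv K                               ∎

  -- Partial sums of Σ 1/n² and their tails

  ζ : ℕ → ℚ
  ζ N = sum N (λ n → inv n * inv n)

  ζ-double : ∀ N → ζ (N ℕ.+ N) ≡ oddSquares N + ½ * ½ * ζ N
  ζ-double zero    = refl
  ζ-double (suc N) = begin
    ζ (suc N ℕ.+ suc N)   ≡⟨ cong (λ i → ζ (suc i)) (ℕ.+-suc N N) ⟩
    ζ (N ℕ.+ N) + inv (N ℕ.+ N) * inv (N ℕ.+ N) + inv (suc (N ℕ.+ N)) * inv (suc (N ℕ.+ N))
      ≡⟨ cong₂ (λ p q → p + q * q + inv (suc (N ℕ.+ N)) * inv (suc (N ℕ.+ N))) (ζ-double N) (cong (λ i → inv (N ℕ.+ i)) (sym (ℕ.+-identityʳ N))) ⟩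
    oddSquares N + ½ * ½ * ζ N + oddRecip N * oddRecip N + inv (suc (N ℕ.+ N)) * inv (suc (N ℕ.+ N))
      ≡⟨ cong (λ q → oddSquares N + ½ * ½ * ζ N + oddRecip N * oddRecip N + q * q) (trans (cong inv (index N)) (sym (inv-* 1 N))) ⟩
    oddSquares N + ½ * ½ * ζ N + oddRecip N * oddRecip N + ½ * inv N * (½ * inv N)
      ≡⟨ solve 4 (λ o z r i → o :+ con ½ :* con ½ :* z :+ r :* r :+ con ½ :* i :* (con ½ :* i) :=
           (o :+ r :* r) :+ con ½ :* con ½ :* (z :+ i :* i)) refl (oddSquares N) (ζ N) (oddRecip N) (inv N) ⟩
    oddSquares (suc N) + ½ * ½ * ζ (suc N) ∎
    where
    open ≡-Reasoning
    index : ∀ N → suc (N ℕ.+ N) ≡ N ℕ.+ 1 ℕ.* suc N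
    index = solveℕ

  -- The square of 4 l is 8 (defect + oddSquares), and by `ζ-double` 4/3 of the odd squares is ζ(2N)
  -- + (ζ(2N) - ζ(N))/3. Everything besides ζ(2N) tends to 0. Here `inv 2` is 1/3 and `inv 5` is
  -- 1/6.
  π²/6-approx : ∀ N → approx π²/6 N ≡ inv 2 * (ι 4 * defect N) + (ζ (N ℕ.+ N) + inv 2 * (ζ (N ℕ.+ N) - ζ N))
  π²/6-approx N = begin
    ι 4 * l * (ι 4 * l) * inv 5
      ≡⟨ solve 3 (λ l o z → con (ι 4) :* l :* (con (ι 4) :* l) :* con (inv 5) :=
           con (inv 2) :* (con (ι 4) :* ((l :* l :+ l :* l) :- o)) :+
           ((o :+ con ½ :* con ½ :* z) :+ con (inv 2) :* ((o :+ con ½ :* con ½ :* z) :- z))) refl l o (ζ N) ⟩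
    inv 2 * (ι 4 * defect N) + ((o + ½ * ½ * ζ N) + inv 2 * ((o + ½ * ½ * ζ N) - ζ N))
      ≡⟨ cong (λ q → inv 2 * (ι 4 * defect N) + (q + inv 2 * (q - ζ N))) (ζ-double N) ⟨
    inv 2 * (ι 4 * defect N) + (ζ (N ℕ.+ N) + inv 2 * (ζ (N ℕ.+ N) - ζ N)) ∎
    where
    open ≡-Reasoning
    l = leibniz N
    o = oddSquares N

  step-mono : ∀ (f : ℕ → ℚ) → (∀ n → f n ≤ f (suc n)) → ∀ {m n} → m ℕ.≤ n → f m ≤ f n
  step-mono f up m≤n = go (ℕ.≤⇒≤′ m≤n)
    where
    go : ∀ {m n} → m ℕ.≤′ n → f m ≤ f n
    go ℕ.≤′-refl        = ≤-refl
    go (ℕ.≤′-step m≤′n) = ≤-trans (go m≤′n) (up _)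

  step-antitone : ∀ (f : ℕ → ℚ) → (∀ n → f (suc n) ≤ f n) → ∀ {m n} → m ℕ.≤ n → f n ≤ f m
  step-antitone f down m≤n = go (ℕ.≤⇒≤′ m≤n)
    where
    go : ∀ {m n} → m ℕ.≤′ n → f n ≤ f m
    go ℕ.≤′-refl        = ≤-refl
    go (ℕ.≤′-step m≤′n) = ≤-trans (down _) (go m≤′n)

  inv*inv-mono : ∀ {m n} → m ℕ.≤ n → ∀ k → inv n * inv k ≤ inv m * inv k
  inv*inv-mono m≤n k = *-monoʳ-≤-nonNeg (inv k) {{inv-nonNeg k}} (inv-antitone m≤n)

  -- upper decreases and lower increases to π²/6; upper (k - 2) is the constant c_k.
  upper lower : ℕ → ℚ
  upper n = ζ (suc n) + inv n
  lower n = ζ n + inv n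

  -- A step adds 1/(n+2)² to the sum and takes 1/(n+1) - 1/(n+2) = 1/((n+1)(n+2)) off the tail
  -- estimate, which is more. For `lower` the added square is 1/(n+1)², which exceeds the same
  -- difference.
  upper-antitone : ∀ {m n} → m ℕ.≤ n → upper n ≤ upper m
  upper-antitone = step-antitone upper λ n → begin
    ζ (suc n) + inv (suc n) * inv (suc n) + inv (suc n)
      ≤⟨ +-monoˡ-≤ (inv (suc n)) (+-monoʳ-≤ (ζ (suc n)) (inv*inv-mono (ℕ.n≤1+n n) (suc n))) ⟩
    ζ (suc n) + inv n * inv (suc n) + inv (suc n)
      ≡⟨ trans (+-assoc (ζ (suc n)) _ _) (cong (_+_ (ζ (suc n))) (trans (+-comm _ (inv (suc n))) (sym (inv-telescope n)))) ⟩
    upper n ∎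
    where open ≤-Reasoning

  lower-mono : ∀ {m n} → m ℕ.≤ n → lower m ≤ lower n
  lower-mono = step-mono lower λ n → begin
    ζ n + inv n                               ≡⟨ cong (_+_ (ζ n)) (trans (inv-telescope n) (+-comm (inv (suc n)) _)) ⟩
    ζ n + (inv n * inv (suc n) + inv (suc n)) ≡⟨ +-assoc (ζ n) _ _ ⟨
    ζ n + inv n * inv (suc n) + inv (suc n)
      ≤⟨ +-monoˡ-≤ (inv (suc n)) (+-monoʳ-≤ (ζ n) (*-monoˡ-≤-nonNeg (inv n) {{inv-nonNeg n}} (inv-antitone (ℕ.n≤1+n n)))) ⟩
    lower (suc n) ∎
    where open ≤-Reasoning

  ζ-mono : ∀ {m n} → m ℕ.≤ n → ζ m ≤ ζ n
  ζ-mono = step-mono ζ λ n → ≤-trans (≤-reflexive (sym (+-identityʳ (ζ n))))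
    (+-monoʳ-≤ (ζ n) (≤-trans (0≤inv (n ℕ.+ n ℕ.* suc n)) (≤-reflexive (sym (inv-* n n)))))

  ζ≤upper : ∀ {m n} → m ℕ.< n → ζ n ≤ upper m
  ζ≤upper {m} {suc n} (s≤s m≤n) = ≤-trans
    (≤-trans (≤-reflexive (sym (+-identityʳ (ζ (suc n))))) (+-monoʳ-≤ (ζ (suc n)) (0≤inv n)))
    (upper-antitone m≤n)

  -- inv 2 * (ι 4 * D) + (z₂ + inv 2 * (z₂ - z)) is the value of π²/6-approx.
  approx-upper : ∀ {D z z₂ u i} → 0ℚ ≤ i → D ≤ ι 6 * i → z₂ ≤ u → z₂ ≤ z + i →
    inv 2 * (ι 4 * D) + (z₂ + inv 2 * (z₂ - z)) ≤ u + ι 9 * i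
  approx-upper {D} {z} {z₂} {u} {i} 0≤i D≤ z₂≤u z₂≤z+i = begin
    inv 2 * (ι 4 * D) + (z₂ + inv 2 * (z₂ - z))
      ≤⟨ +-mono-≤ (*-monoˡ-≤-nonNeg (inv 2) (*-monoˡ-≤-nonNeg (ι 4) D≤))
           (+-mono-≤ z₂≤u (*-monoˡ-≤-nonNeg (inv 2) (+-monoˡ-≤ (- z) z₂≤z+i))) ⟩
    inv 2 * (ι 4 * (ι 6 * i)) + (u + inv 2 * ((z + i) - z))
      ≡⟨ solve 3 (λ i u z → con (inv 2) :* (con (ι 4) :* (con (ι 6) :* i)) :+ (u :+ con (inv 2) :* ((z :+ i) :- z)) :=
           u :+ (con (ι 8) :+ con (inv 2)) :* i) refl i u z ⟩
    -- 4/3 of 6 i is 8 i; the remaining third of i is rounded up, so that the upper and the lower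
    -- estimate share the constant 9.
    u + (ι 8 + inv 2) * i
      ≤⟨ +-monoʳ-≤ u (*-monoʳ-≤-nonNeg i {{nonNegative 0≤i}} (+-monoʳ-≤ (ι 8) (inv-antitone {0} {2} z≤n))) ⟩
    u + ι 9 * i                             ∎
    where open ≤-Reasoning

  -- The defect costs at most 8 i. The ninth i pays for the one on the left, which is to be the tail
  -- 1/(N+1) of `lower N`, enlarged to `inv K`.
  approx-lower : ∀ {D z z₂ i} → - (ι 6 * i) ≤ D → z ≤ z₂ →
    z + i ≤ (inv 2 * (ι 4 * D) + (z₂ + inv 2 * (z₂ - z))) + ι 9 * i
  approx-lower {D} {z} {z₂} {i} D≥ z≤z₂ = begin
    z + i
      ≡⟨ solve 2 (λ z i → z :+ i := (con (inv 2) :* (con (ι 4) :* (:- (con (ι 6) :* i))) :+ (z :+ con (inv 2) :* (z :- z))) :+ con (ι 9) :* i)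
           refl z i ⟩
    (inv 2 * (ι 4 * (- (ι 6 * i))) + (z + inv 2 * (z - z))) + ι 9 * i
      ≤⟨ +-monoˡ-≤ (ι 9 * i) (+-mono-≤
           (*-monoˡ-≤-nonNeg (inv 2) (*-monoˡ-≤-nonNeg (ι 4) D≥))
           (+-mono-≤ z≤z₂ (*-monoˡ-≤-nonNeg (inv 2) (+-monoˡ-≤ (- z) z≤z₂)))) ⟩
    (inv 2 * (ι 4 * D) + (z₂ + inv 2 * (z₂ - z))) + ι 9 * i ∎
    where open ≤-Reasoning

  square≤⇒pred≤ : ∀ {K N} → suc K ℕ.* suc K ℕ.≤ N → K ℕ.≤ N
  square≤⇒pred≤ {K} K²≤N = ℕ.≤-trans (ℕ.≤-trans (ℕ.n≤1+n K) (ℕ.m≤m*n (suc K) (suc K))) K²≤N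

  -- For N = M + 1, `upper M` is ζ(N) + 1/N and bounds all later partial sums; moreover K ≤ M.
  ζ-double≤ : ∀ K N → suc K ℕ.* suc K ℕ.≤ N → ζ (N ℕ.+ N) ≤ ζ N + inv K
  ζ-double≤ K (suc M) K²≤N = ≤-trans (ζ≤upper {M} (ℕ.m≤m+n (suc M) (suc M)))
    (+-monoʳ-≤ (ζ (suc M)) (inv-antitone (ℕ.≤-pred (ℕ.≤-trans (ℕ.m≤m*n (suc K) (suc K)) K²≤N))))

  π²/6-approx-upper : ∀ j K N → j ℕ.< N → suc K ℕ.* suc K ℕ.≤ N → approx π²/6 N ≤ upper j + ι 9 * inv K
  π²/6-approx-upper j K N j<N K²≤N = ≤-trans (≤-reflexive (π²/6-approx N))
    (approx-upper {defect N} {ζ N} (0≤inv K)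
      (≤-trans (p≤∣p∣ (defect N)) (∣defect∣-bound K N K²≤N)) (ζ≤upper (ℕ.m≤n⇒m≤n+o N j<N)) (ζ-double≤ K N K²≤N))

  -- `upper j` exceeds `lower (suc j)` by exactly 1/((j+1)(j+2)). With j = k - 2 this is the slack
  -- 1/((k-1)k) of the theorem.
  π²/6-approx-lower : ∀ j K N → j ℕ.< N → suc K ℕ.* suc K ℕ.≤ N →
    upper j ≤ approx π²/6 N + inv j * inv (suc j) + ι 9 * inv K
  π²/6-approx-lower j K N j<N K²≤N = begin
    ζ (suc j) + inv j                                ≡⟨ cong (_+_ (ζ (suc j))) (inv-telescope j) ⟩
    ζ (suc j) + (inv (suc j) + t)                    ≡⟨ +-assoc (ζ (suc j)) (inv (suc j)) t ⟨
    lower (suc j) + t                                ≤⟨ +-monoˡ-≤ t (lower-mono j<N) ⟩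
    lower N + t                                      ≤⟨ +-monoˡ-≤ t (+-monoʳ-≤ (ζ N) (inv-antitone {K} {N} (square≤⇒pred≤ K²≤N))) ⟩
    ζ N + inv K + t
      ≤⟨ +-monoˡ-≤ t (approx-lower {defect N} {ζ N} {ζ (N ℕ.+ N)} {inv K} -6i≤D (ζ-mono (ℕ.m≤m+n N N))) ⟩
    (inv 2 * (ι 4 * defect N) + (ζ (N ℕ.+ N) + inv 2 * (ζ (N ℕ.+ N) - ζ N))) + ι 9 * inv K + t
      ≡⟨ cong (λ q → q + ι 9 * inv K + t) (π²/6-approx N) ⟨
    approx π²/6 N + ι 9 * inv K + t
      ≡⟨ solve 3 (λ a b c → a :+ b :+ c := a :+ c :+ b) refl (approx π²/6 N) (ι 9 * inv K) t ⟩
    approx π²/6 N + t + ι 9 * inv K                  ∎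
    where
    open ≤-Reasoning
    t = inv j * inv (suc j)
    -6i≤D : - (ι 6 * inv K) ≤ defect N
    -6i≤D = begin
      - (ι 6 * inv K)    ≤⟨ neg-antimono-≤ (∣defect∣-bound K N K²≤N) ⟩
      - ∣ defect N ∣     ≡⟨ cong -_ (∣-p∣≡∣p∣ (defect N)) ⟨
      - ∣ - defect N ∣   ≤⟨ neg-antimono-≤ (p≤∣p∣ (- defect N)) ⟩
      - - defect N       ≡⟨ solve 1 (λ d → :- (:- d) := d) refl (defect N) ⟩
      defect N           ∎

  -- Stated for a variable q: at a concrete rational such as upper j, conversion
  -- checking would unfold the arithmetic of ℚ.
  ≤ʳ-fromℚ : ∀ x q → (∀ ε → 0ℚ < ε → ∃[ N ] (∀ n → N ℕ.≤ n → approx x n ≤ q + ε)) → x ≤ʳ fromℚ q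
  ≤ʳ-fromℚ x q le = le

  fromℚ-≤ʳ : ∀ x p q → (∀ ε → 0ℚ < ε → ∃[ N ] (∀ n → N ℕ.≤ n → p ≤ approx x n + q + ε)) → fromℚ p ≤ʳ x +ʳ fromℚ q
  fromℚ-≤ʳ (real _ _) p q le = le

  9inv-archimedean : ∀ ε → 0ℚ < ε → ∃[ K ] ι 9 * inv K ≤ ε
  9inv-archimedean ε ε>0 with inv-archimedean (ε * inv 8) (positive⁻¹ _ {{pos*pos⇒pos ε {{positive ε>0}} (inv 8)}})
  ... | K , K≤ = K , ≤-trans (*-monoˡ-≤-nonNeg (ι 9) K≤)
    (≤-reflexive (solve 1 (λ e → con (ι 9) :* (e :* con (inv 8)) := e) refl ε))

  thresholds : ∀ j K {N} → suc j ℕ.+ suc K ℕ.* suc K ℕ.≤ N → j ℕ.< N × suc K ℕ.* suc K ℕ.≤ N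
  thresholds j K le = ℕ.≤-trans (ℕ.m≤m+n (suc j) (suc K ℕ.* suc K)) le , ℕ.≤-trans (ℕ.m≤n+m (suc K ℕ.* suc K) (suc j)) le

  π²/6≤upper : ∀ j → π²/6 ≤ʳ fromℚ (upper j)
  π²/6≤upper j = ≤ʳ-fromℚ π²/6 (upper j) λ ε ε>0 →
    let K , K≤ε = 9inv-archimedean ε ε>0 in
    suc j ℕ.+ suc K ℕ.* suc K , λ N le →
      let j<N , K²≤N = thresholds j K le in
      ≤-trans {approx π²/6 N} {upper j + ι 9 * inv K} {upper j + ε}
        (π²/6-approx-upper j K N j<N K²≤N) (+-monoʳ-≤ (upper j) {ι 9 * inv K} {ε} K≤ε)

  upper≤π²/6+ : ∀ j 2≤k → fromℚ (upper j) ≤ʳ π²/6 +ʳ 1/[k-1]k (suc (suc j)) 2≤k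
  upper≤π²/6+ j 2≤k = fromℚ-≤ʳ π²/6 (upper j) (inv (suc j ℕ.+ j ℕ.* suc (suc j))) λ ε ε>0 →
    let K , K≤ε = 9inv-archimedean ε ε>0 in
    suc j ℕ.+ suc K ℕ.* suc K , λ N le →
      let j<N , K²≤N = thresholds j K le in begin
      upper j                                               ≤⟨ π²/6-approx-lower j K N j<N K²≤N ⟩
      approx π²/6 N + inv j * inv (suc j) + ι 9 * inv K
        ≤⟨ +-monoʳ-≤ (approx π²/6 N + inv j * inv (suc j)) {ι 9 * inv K} {ε} K≤ε ⟩
      approx π²/6 N + inv j * inv (suc j) + ε               ≡⟨ cong (λ q → approx π²/6 N + q + ε) (inv-* j (suc j)) ⟩
      approx π²/6 N + inv (suc j ℕ.+ j ℕ.* suc (suc j)) + ε ∎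
    where open ≤-Reasoning

-- Finite sets and walks

open import Data.Bool.Base using (true; false)
open import Data.Fin.Subset using (Subset; ∣_∣; _∪_; ⋃; ⁅_⁆; _-_) renaming (_∈_ to _∈ˢ_)
open import Data.Fin.Subset.Properties using (x∈p⇒∣p-x∣<∣p∣; x∈p∧x≢y⇒x∈p-y; ∣⊥∣≡0; ∣⁅x⁆∣≡1; ∈⊤)
open import Relation.Binary.Construct.Closure.ReflexiveTransitive using (Star; ε; _◅_)

Unique-⊆-length : ∀ {A : Set} {xs ys : List A} → Unique xs → xs ⊆ ys → length xs ℕ.≤ length ys
Unique-⊆-length {xs = []}     _          _     = z≤n
Unique-⊆-length {xs = x ∷ xs} (x∉ ∷ uxs) xs⊆ys with ∈-∃++ (xs⊆ys (here refl))
... | as , bs , refl = ℕ.≤-trans (s≤s (Unique-⊆-length uxs avoid)) (ℕ.≤-reflexive (begin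
  suc (length (as ++ bs))        ≡⟨ cong suc (length-++ as) ⟩
  suc (length as ℕ.+ length bs)  ≡⟨ ℕ.+-suc (length as) (length bs) ⟨
  length as ℕ.+ suc (length bs)  ≡⟨ length-++ as ⟨
  length (as ++ x ∷ bs)          ∎))
  where
  open ≡-Reasoning
  avoid : xs ⊆ as ++ bs
  avoid {z} z∈xs with ∈-++⁻ as (xs⊆ys (there z∈xs))
  ... | inj₁ z∈as          = ∈-++⁺ˡ z∈as
  ... | inj₂ (there z∈bs)  = ∈-++⁺ʳ as z∈bs
  ... | inj₂ (here refl)   = ⊥-elim (All.lookup x∉ z∈xs refl)

Unique-∣∣ : ∀ {n} {xs : List (Fin n)} {S : Subset n} → Unique xs → All (_∈ˢ S) xs → length xs ℕ.≤ ∣ S ∣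
Unique-∣∣ []         []           = z≤n
Unique-∣∣ (x∉ ∷ uxs) (x∈S ∷ xs∈S) = ℕ.≤-trans
  (s≤s (Unique-∣∣ uxs (All.zipWith (λ (x≢y , y∈S) → x∈p∧x≢y⇒x∈p-y y∈S (x≢y ∘ sym)) (x∉ , xs∈S))))
  (x∈p⇒∣p-x∣<∣p∣ x∈S)

∣∪∣≤ : ∀ {n} (p q : Subset n) → ∣ p ∪ q ∣ ℕ.≤ ∣ p ∣ ℕ.+ ∣ q ∣
∣∪∣≤ []          []          = z≤n
∣∪∣≤ (true ∷ p)  (true ∷ q)  = s≤s (ℕ.≤-trans (∣∪∣≤ p q) (ℕ.+-monoʳ-≤ ∣ p ∣ (ℕ.n≤1+n ∣ q ∣)))
∣∪∣≤ (true ∷ p)  (false ∷ q) = s≤s (∣∪∣≤ p q)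
∣∪∣≤ (false ∷ p) (true ∷ q)  = ℕ.≤-trans (s≤s (∣∪∣≤ p q)) (ℕ.≤-reflexive (sym (ℕ.+-suc ∣ p ∣ ∣ q ∣)))
∣∪∣≤ (false ∷ p) (false ∷ q) = ∣∪∣≤ p q

∣⋃⁅⁆∣≤ : ∀ {n} (xs : List (Fin n)) → ∣ ⋃ (map ⁅_⁆ xs) ∣ ℕ.≤ length xs
∣⋃⁅⁆∣≤ {n} []   = ℕ.≤-reflexive (∣⊥∣≡0 n)
∣⋃⁅⁆∣≤ (x ∷ xs) = ℕ.≤-trans (∣∪∣≤ ⁅ x ⁆ _) (ℕ.+-mono-≤ (ℕ.≤-reflexive (∣⁅x⁆∣≡1 x)) (∣⋃⁅⁆∣≤ xs))

module _ {n : ℕ} where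
  open DecMembership (_≟_ {n}) using (_∈?_)

  image : (Fin n → Fin n) → List (Fin n)
  image f = deduplicate _≟_ (map f (allFin n))

  image-unique : ∀ f → Unique (image f)
  image-unique f = UniqueDec.deduplicate-! _≟_ (map f (allFin n))

  ∈-image⁺ : ∀ f w → f w ∈ image f
  ∈-image⁺ f w = ∈-deduplicate⁺ _≟_ (∈-map⁺ f (∈-allFin w))

  ∈-image⁻ : ∀ f {x} → x ∈ image f → ∃[ w ] x ≡ f w
  ∈-image⁻ f x∈ with ∈-map⁻ f (∈-deduplicate⁻ _≟_ (map f (allFin n)) x∈)
  ... | w , _ , x≡fw = w , x≡fw

  -- Under M all of C becomes the single point p, and the rest of X yields at most ∣X∣ - ∣C∣ points.
  -- The case in view has C the vertices of a cycle and M its contraction.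
  shrink : ∀ {X X′ C : List (Fin n)} (M : Fin n → Fin n) p →
    Unique X → Unique X′ → Unique C → C ⊆ X →
    (∀ {c} → c ∈ C → M c ≡ p) → (∀ {y} → y ∈ X′ → ∃[ x ] (x ∈ X × y ≡ M x)) →
    length X′ ℕ.+ length C ℕ.≤ suc (length X)
  shrink {X} {X′} {C} M p uX uX′ uC C⊆X collapse cover = begin
    length X′ ℕ.+ length C       ≤⟨ ℕ.+-monoˡ-≤ (length C) (Unique-⊆-length uX′ X′⊆) ⟩
    suc (length (map M R)) ℕ.+ length C ≡⟨ cong (λ l → suc l ℕ.+ length C) (length-map M R) ⟩
    suc (length R ℕ.+ length C)  ≡⟨ cong suc (length-++ R) ⟨
    suc (length (R ++ C))        ≤⟨ s≤s (Unique-⊆-length (Unique.++⁺ (Unique.filter⁺ ∉C? uX) uC disjoint) R++C⊆X) ⟩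
    suc (length X)               ∎
    where
    open ℕ.≤-Reasoning
    ∉C? : ∀ x → Dec (x ∉ C)
    ∉C? x = ¬? (x ∈? C)
    R = filter ∉C? X
    disjoint : ∀ {x} → ¬ (x ∈ R × x ∈ C)
    disjoint (x∈R , x∈C) = proj₂ (∈-filter⁻ ∉C? {xs = X} x∈R) x∈C
    R++C⊆X : R ++ C ⊆ X
    R++C⊆X x∈ with ∈-++⁻ R x∈
    ... | inj₁ x∈R = proj₁ (∈-filter⁻ ∉C? {xs = X} x∈R)
    ... | inj₂ x∈C = C⊆X x∈C
    X′⊆ : X′ ⊆ p ∷ map M R
    X′⊆ y∈X′ with cover y∈X′
    ... | x , x∈X , refl with x ∈? C
    ...   | yes x∈C = here (collapse x∈C)
    ...   | no  x∉C = there (∈-map⁺ M (∈-filter⁺ ∉C? x∈X x∉C))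

-- Walks and simple paths

module Walks {n m : ℕ} (s t : Fin m → Fin n) where
  open DecMembership (_≟_ {n}) using (_∈?_)

  data Walk (P : Fin m → Set) : Fin n → Fin n → List (Fin m) → Set where
    []   : ∀ {u} → Walk P u u []
    cons : ∀ {u v e es} → s e ≡ u → P e → Walk P (t e) v es → Walk P u v (e ∷ es)

  module _ {P : Fin m → Set} where

    _++ʷ_ : ∀ {u v w es fs} → Walk P u v es → Walk P v w fs → Walk P u w (es ++ fs)
    []            ++ʷ w₂ = w₂
    cons eq p w₁  ++ʷ w₂ = cons eq p (w₁ ++ʷ w₂)

    edges-satisfy : ∀ {u v es} → Walk P u v es → All P es
    edges-satisfy []           = []
    edges-satisfy (cons _ p w) = p ∷ edges-satisfy w

    start : ∀ {u v es} → Walk P u v es → u ≡ v ⊎ u ∈ map s es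
    start []             = inj₁ refl
    start (cons refl _ _) = inj₂ (here refl)

    split : ∀ {u v es z} → Walk P u v es → z ∈ map s es →
      ∃[ as ] ∃[ bs ] (Walk P u z as × Walk P z v bs × es ≡ as ++ bs)
    split w@(cons refl _ _) (here refl) = _ , _ , [] , w , refl
    split (cons eq p w)     (there z∈) with split w z∈
    ... | _ , _ , w₁ , w₂ , refl = _ , _ , cons eq p w₁ , w₂ , refl

    endpoints-in : ∀ {u v es Z} → Walk P u v es → map s es ⊆ Z → v ∈ Z → All (λ e → s e ∈ Z × t e ∈ Z) es
    endpoints-in []           _  _   = []
    endpoints-in (cons _ _ w) ⊆Z v∈Z = (⊆Z (here refl) , target-in (start w)) ∷ endpoints-in w (⊆Z ∘ there) v∈Z
      where
      target-in : _ ⊎ _ → _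
      target-in (inj₁ refl) = v∈Z
      target-in (inj₂ t∈)   = ⊆Z (there t∈)

    -- Q is a property inherited from the walk being simplified; it records that a path avoids a
    -- vertex set or stays inside it. Excluding the end from the sources lets two such paths be
    -- joined into a simple cycle.
    record SimpleWalk (Q : Fin m → Set) (u v : Fin n) : Set where
      constructor simple
      field
        {edges}  : List (Fin m)
        walk     : Walk P u v edges
        within   : All Q edges
        distinct : Unique (map s edges)
        end∉     : v ∉ map s edges

    open SimpleWalk

    suffix : ∀ {Q u v z es} → Walk P u v es → All Q es → Unique (map s es) → v ∉ map s es →
      z ∈ map s es → SimpleWalk Q z v
    suffix w@(cons refl _ _) qs       us       v∉ (here refl) = simple w qs us v∉
    suffix (cons _ _ w)      (_ ∷ qs) (_ ∷ us) v∉ (there z∈)  = suffix w qs us (v∉ ∘ there) z∈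

    -- Loop erasure from the far end: the tail is made simple first, and if u recurs on it, only the
    -- part from that occurrence on is kept.
    simplify : ∀ {Q u v es} → Walk P u v es → All Q es → SimpleWalk Q u v
    simplify []                          []       = simple [] [] [] λ ()
    simplify {v = v} (cons {u} refl p w) (q ∷ qs) with simplify w qs | u ≟ v
    ... | _               | yes refl = simple [] [] [] λ ()
    ... | simple {es} w′ qs′ us v∉ | no u≢v with u ∈? map s es
    ...   | yes u∈ = suffix w′ qs′ us v∉ u∈
    ...   | no  u∉ = simple (cons refl p w′) (q ∷ qs′) (All.¬Any⇒All¬ _ u∉ ∷ us)
      λ { (here v≡u) → u≢v (sym v≡u) ; (there v∈) → v∉ v∈ }

    truncate : ∀ {u v es T} → Walk P u v es → v ∈ T →
      ∃[ b ] ∃[ fs ] (b ∈ T × Walk P u b fs × All (λ e → s e ∉ T) fs)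
    truncate []                           v∈T = _ , _ , v∈T , [] , []
    truncate {T = T} (cons {u} refl p w)  v∈T with u ∈? T
    ... | yes u∈T = _ , _ , u∈T , [] , []
    ... | no  u∉T with truncate w v∈T
    ...   | _ , _ , b∈T , w′ , out = _ , _ , b∈T , cons refl p w′ , u∉T ∷ out

    linked : ∀ {u v es} f → Walk P u v es → v ≡ s f → Linked (λ e g → t e ≡ s g) (es ∷ʳ f)
    linked f []                              _    = [-]
    linked f (cons _ _ [])                   v≡sf = v≡sf ∷ [-]
    linked f (cons _ _ w@(cons eq _ _))      v≡sf = sym eq ∷ linked f w v≡sf

  -- Ear decompositions

  module Ears {P : Fin m → Set} {X : List (Fin n)} {a b : ℕ}
    (connected : ∀ {u v} → u ∈ X → v ∈ X → ∃[ es ] Walk P u v es)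
    (target∈X  : ∀ e → t e ∈ X)
    (ear-cost  : ∀ {e es} → Walk P (s e) (s e) (e ∷ es) → Unique (map s (e ∷ es)) →
                 ∀ {l} → l ℕ.≤ length es → a ℕ.* l ℕ.≤ b ℕ.* suc l)
    where

    -- U serves to count edges: `T-strong` asks for walks of P-edges inside T, whether or not they
    -- belong to U. `cost` is a(∣T∣ - 1) ≤ b∣U∣ without subtraction; an ear with l new vertices adds
    -- a l on the left and b (l + 1) on the right.
    record Core (T : List (Fin n)) (U : List (Fin m)) : Set where
      field
        T-unique : Unique T
        U-unique : Unique U
        U-edges  : All P U
        U-inside : All (λ e → s e ∈ T × t e ∈ T) U
        T-strong : ∀ {u v} → u ∈ T → v ∈ T → ∃[ es ] (Walk P u v es × All (λ e → s e ∈ T) es)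
        cost     : a ℕ.* length T ℕ.≤ b ℕ.* length U ℕ.+ a

    open Core
    open SimpleWalk

    Extension : List (Fin n) → Fin n → Set
    Extension T v = ∃[ T′ ] ∃[ U′ ] (Core T′ U′ × T ⊆ T′ × v ∈ T′)

    module _ {T : List (Fin n)} {U : List (Fin m)} {r : Fin n} {e : Fin m} (core : Core T U) (r∈X : r ∈ X) (r∈T : r ∈ T)
             (e∈P : P e) (se∈T : s e ∈ T) (te∉T : t e ∉ T) where

      -- The ear leaves T through e and returns to T at y; a path inside T from y to
      -- s e closes it to a simple cycle.
      add-ear : Extension T (t e)
      add-ear with truncate (proj₂ (connected (target∈X e) r∈X)) r∈T
      ... | y , _ , y∈T , toT , outside with simplify toT outside | T-strong core y∈T se∈T
      ...   | simple {ear} w₁ out₁ u₁ _ | _ , back , inside with simplify back inside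
      ...     | simple {rest} w₂ in₂ u₂ se∉ = T′ , U ++ e ∷ ear , core′ , ∈-++⁺ˡ , te∈T′
        where
        T′ = T ++ map s ear

        sources-out : ∀ {z} → z ∈ map s ear → z ∉ T
        sources-out z∈ with ∈-map⁻ s z∈
        ... | _ , f∈ , refl = All.lookup out₁ f∈

        sources-in : ∀ {z} → z ∈ map s rest → z ∈ T
        sources-in z∈ with ∈-map⁻ s z∈
        ... | _ , f∈ , refl = All.lookup in₂ f∈

        -- The source of e lies in T, hence not on the ear, and it is the end of the return path,
        -- hence not among its sources. Ear and return path are separated by T.
        cycle-unique : Unique (map s (e ∷ ear ++ rest))
        cycle-unique = subst (λ zs → Unique (s e ∷ zs)) (sym (map-++ s ear rest))
          (All.++⁺ (All.¬Any⇒All¬ _ (λ se∈ → sources-out se∈ se∈T)) (All.¬Any⇒All¬ _ se∉)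
           ∷ Unique.++⁺ u₁ u₂ (λ (z∈₁ , z∈₂) → sources-out z∈₁ (sources-in z∈₂)))

        ear-cost′ : a ℕ.* length ear ℕ.≤ b ℕ.* suc (length ear)
        ear-cost′ = ear-cost (cons refl e∈P (w₁ ++ʷ w₂)) cycle-unique
          (ℕ.≤-trans (ℕ.m≤m+n (length ear) (length rest)) (ℕ.≤-reflexive (sym (length-++ ear))))

        te∈T′ : t e ∈ T′
        te∈T′ with start w₁
        ... | inj₁ refl = ∈-++⁺ˡ y∈T
        ... | inj₂ te∈  = ∈-++⁺ʳ T te∈

        ear-in : All (λ f → s f ∈ T′) ear
        ear-in = All.tabulate (∈-++⁺ʳ T ∘ ∈-map⁺ s)

        inner : ∀ {u v} → u ∈ T → v ∈ T → ∃[ es ] (Walk P u v es × All (λ f → s f ∈ T′) es)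
        inner u∈T v∈T with T-strong core u∈T v∈T
        ... | _ , w , ins = _ , w , All.map ∈-++⁺ˡ ins

        reach : ∀ {z} → z ∈ T′ → ∃[ es ] (Walk P (s e) z es × All (λ f → s f ∈ T′) es)
        reach z∈ with ∈-++⁻ T z∈
        ... | inj₁ z∈T = inner se∈T z∈T
        ... | inj₂ z∈ear with split w₁ z∈ear
        ...   | as , _ , w , _ , eq = _ , cons refl e∈P w , ∈-++⁺ˡ se∈T ∷ All.++⁻ˡ as (subst (All _) eq ear-in)

        exit-walk : ∀ {z} → z ∈ T′ → ∃[ es ] (Walk P z y es × All (λ f → s f ∈ T′) es)
        exit-walk z∈ with ∈-++⁻ T z∈
        ... | inj₁ z∈T = inner z∈T y∈T
        ... | inj₂ z∈ear with split w₁ z∈ear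
        ...   | as , _ , _ , w , eq = _ , w , All.++⁻ʳ as (subst (All _) eq ear-in)

        core′ : Core T′ (U ++ e ∷ ear)
        core′ .T-unique = Unique.++⁺ (T-unique core) u₁ (λ (z∈T , z∈ear) → sources-out z∈ear z∈T)
        -- By `U-inside` the added edges are new: e ends outside T, and the edges of the ear start
        -- outside T.
        core′ .U-unique = Unique.++⁺ (U-unique core)
          (All.tabulate (λ { f∈ refl → All.lookup out₁ f∈ se∈T }) ∷ Unique.map⁻ u₁)
          λ { (f∈U , here refl)   → te∉T (proj₂ (All.lookup (U-inside core) f∈U))
            ; (f∈U , there f∈ear) → All.lookup out₁ f∈ear (proj₁ (All.lookup (U-inside core) f∈U)) }
        core′ .U-edges  = All.++⁺ (U-edges core) (e∈P ∷ edges-satisfy w₁)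
        core′ .U-inside = All.++⁺ (All.map (λ (s∈ , t∈) → ∈-++⁺ˡ s∈ , ∈-++⁺ˡ t∈) (U-inside core))
          ((∈-++⁺ˡ se∈T , te∈T′) ∷ endpoints-in w₁ (∈-++⁺ʳ T) (∈-++⁺ˡ y∈T))
        -- Every route runs out to y, through T to the source of e, and from there to its goal.
        core′ .T-strong u∈ v∈ with exit-walk u∈ | inner y∈T se∈T | reach v∈
        ... | _ , x₁ , i₁ | _ , x₂ , i₂ | _ , x₃ , i₃ = _ , x₁ ++ʷ (x₂ ++ʷ x₃) , All.++⁺ i₁ (All.++⁺ i₂ i₃)
        core′ .cost     = begin
          a ℕ.* length T′                                     ≡⟨ cong (a ℕ.*_) (trans (length-++ T) (cong (length T ℕ.+_) (length-map s ear))) ⟩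
          a ℕ.* (length T ℕ.+ length ear)                     ≡⟨ ℕ.*-distribˡ-+ a (length T) (length ear) ⟩
          a ℕ.* length T ℕ.+ a ℕ.* length ear                 ≤⟨ ℕ.+-mono-≤ (cost core) ear-cost′ ⟩
          b ℕ.* length U ℕ.+ a ℕ.+ b ℕ.* suc (length ear)     ≡⟨ rearrange a b (length U) (suc (length ear)) ⟩
          b ℕ.* (length U ℕ.+ suc (length ear)) ℕ.+ a         ≡⟨ cong (λ l → b ℕ.* l ℕ.+ a) (length-++ U) ⟨
          b ℕ.* length (U ++ e ∷ ear) ℕ.+ a                   ∎
          where
          open ℕ.≤-Reasoning
          rearrange : ∀ a b u l → b ℕ.* u ℕ.+ a ℕ.+ b ℕ.* l ≡ b ℕ.* (u ℕ.+ l) ℕ.+ a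
          rearrange = solveℕ

    -- Whenever the next edge of the walk leaves the current T, it opens an ear that takes in its
    -- target. The vertex r of T is one to which every ear can find its way back.
    absorb-walk : ∀ {T U r u v es} → Core T U → r ∈ X → r ∈ T → Walk P u v es → u ∈ T → Extension T v
    absorb-walk core r∈X r∈T []                        u∈T = _ , _ , core , id , u∈T
    absorb-walk {T} core r∈X r∈T (cons {e = e} refl p w) u∈T with t e ∈? T
    ... | yes te∈T = absorb-walk core r∈X r∈T w te∈T
    ... | no  te∉T with add-ear core r∈X r∈T p u∈T te∉T
    ...   | _ , _ , core₁ , T⊆₁ , te∈ with absorb-walk core₁ r∈X (T⊆₁ r∈T) w te∈
    ...     | _ , _ , core₂ , T⊆₂ , v∈ = _ , _ , core₂ , T⊆₂ ∘ T⊆₁ , v∈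

    absorb : ∀ {T U r} ys → ys ⊆ X → Core T U → r ∈ X → r ∈ T → ∃[ T′ ] ∃[ U′ ] (Core T′ U′ × T ⊆ T′ × ys ⊆ T′)
    absorb []       _    core _   _   = _ , _ , core , id , λ ()
    absorb (y ∷ ys) ys⊆X core r∈X r∈T with absorb-walk core r∈X r∈T (proj₂ (connected r∈X (ys⊆X (here refl)))) r∈T
    ... | _ , _ , core₁ , T⊆₁ , y∈ with absorb ys (ys⊆X ∘ there) core₁ r∈X (T⊆₁ r∈T)
    ...   | _ , _ , core₂ , T⊆₂ , ys⊆ = _ , _ , core₂ , T⊆₂ ∘ T⊆₁ , λ { (here refl) → T⊆₂ y∈ ; (there z∈) → ys⊆ z∈ }

    singleton : ∀ r → Core (r ∷ []) []
    singleton r = record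
      { T-unique = [] ∷ [] ; U-unique = [] ; U-edges = [] ; U-inside = []
      ; T-strong = λ { (here refl) (here refl) → _ , [] , [] }
      ; cost = ℕ.≤-trans (ℕ.≤-reflexive (ℕ.*-identityʳ a)) (ℕ.m≤n+m a (b ℕ.* 0)) }

    spanning-cost : ∀ {o} → Unique X → (∀ {U} → Unique U → All P U → length U ℕ.≤ o) →
      a ℕ.* length X ℕ.≤ b ℕ.* o ℕ.+ a
    spanning-cost {o} X-unique few = go X id X-unique
      where
      -- Y stands for X, a module parameter, so that it can be matched on.
      go : ∀ Y → Y ⊆ X → Unique Y → a ℕ.* length Y ℕ.≤ b ℕ.* o ℕ.+ a
      go []      _   _  = ℕ.≤-trans (ℕ.≤-reflexive (ℕ.*-zeroʳ a)) z≤n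
      go Y@(r ∷ _) Y⊆X uY with absorb Y Y⊆X (singleton r) (Y⊆X (here refl)) (here refl)
      ... | T , U , core , _ , Y⊆T = begin
        a ℕ.* length Y          ≤⟨ ℕ.*-monoʳ-≤ a (Unique-⊆-length uY Y⊆T) ⟩
        a ℕ.* length T          ≤⟨ cost core ⟩
        b ℕ.* length U ℕ.+ a    ≤⟨ ℕ.+-monoˡ-≤ a (ℕ.*-monoʳ-≤ b (few (U-unique core) (U-edges core))) ⟩
        b ℕ.* o ℕ.+ a           ∎
        where open ℕ.≤-Reasoning

-- Contraction and the algorithm

module _ (G : Digraph) where
  open Digraph G
  open Contracted

  order : Contracted G → ℕ
  order H = length (image (rep H))

  -- An SCSS consists of original edges, whereas the cycles of the algorithm consist of live ones.
  -- This invariant of contraction carries cycles from the former to the latter.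
  LiveParallel : Contracted G → Set
  LiveParallel H = ∀ e → ¬ Loop H e → ∃[ f ] (f ∈ˢ live H × Parallel H e f)

  contract-pair-respects : ∀ {u v H H′} → ContractPair G u v H H′ → ∀ {x y} → rep H x ≡ rep H y → rep H′ x ≡ rep H′ y
  contract-pair-respects {u} {v} cp {x} {y} eq =
    trans (ContractPair.merged cp x) (trans (cong (merge G u v) eq) (sym (ContractPair.merged cp y)))

  liveParallel-contract : ∀ {u v H H′} → ContractPair G u v H H′ → LiveParallel H → LiveParallel H′
  liveParallel-contract cp lp e ¬loop with lp e (¬loop ∘ contract-pair-respects cp)
  ... | f , f∈ , s≡ , t≡ with ContractPair.kept cp f∈
          (λ loop → ¬loop (trans (contract-pair-respects cp s≡) (trans loop (sym (contract-pair-respects cp t≡)))))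
  ...   | g , g∈ , s≡′ , t≡′ = g , g∈ , trans (contract-pair-respects cp s≡) s≡′ , trans (contract-pair-respects cp t≡) t≡′

  liveParallel-order : ∀ {es H H′} → ContractInOrder G es H H′ → LiveParallel H → LiveParallel H′
  liveParallel-order []       lp = lp
  liveParallel-order (c ∷ cs) lp = liveParallel-order cs (liveParallel-contract c lp)

  merge-endpoints : ∀ u v → merge G u v u ≡ merge G u v v
  merge-endpoints u v with u ≟ v | v ≟ v
  ... | yes _ | yes _   = refl
  ... | no _  | yes _   = refl
  ... | _     | no  v≢v = ⊥-elim (v≢v refl)

  -- M is the composite of the merges. An edge collapses when its turn comes, and later merges
  -- cannot separate its ends again, so the order of contraction does not matter.
  contraction-map : ∀ {es H H′} → ContractInOrder G es H H′ →
    ∃[ M ] ((∀ w → rep H′ w ≡ M (rep H w)) × All (λ e → M (source H e) ≡ M (target H e)) es)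
  contraction-map [] = id , (λ _ → refl) , []
  contraction-map {e ∷ _} {H} (c ∷ cs) with contraction-map cs
  ... | M , M-rep , M-loops = M ∘ m ,
    (λ w → trans (M-rep w) (cong M (ContractPair.merged c w))) ,
    cong M (merge-endpoints (source H e) (target H e)) ∷
    All.map (λ {f} eq → trans (cong M (sym (ContractPair.merged c (src f)))) (trans eq (cong M (ContractPair.merged c (tgt f))))) M-loops
    where m = merge G (source H e) (target H e)

  linked-collapse : ∀ (H : Contracted G) {e : Edge G} {es} (M : Vertex G → Vertex G) → Linked (λ f g → target H f ≡ source H g) (e ∷ es) →
    All (λ f → M (source H f) ≡ M (target H f)) (e ∷ es) → All (λ f → M (source H f) ≡ M (source H e)) (e ∷ es)
  linked-collapse H M [-]        _            = refl ∷ []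
  linked-collapse H M (eq ∷ lnk) (loop ∷ ls)  = refl ∷
    All.map (λ eq′ → trans eq′ (sym (trans loop (cong M eq)))) (linked-collapse H M lnk ls)

  contract-cycle-order : ∀ {H H′} es → Cycle H es → ContractEdges G es H H′ → order H′ ℕ.+ length es ℕ.≤ suc (order H)
  contract-cycle-order {H} {H′} es@(e ∷ fs) (_ , lnk , uniq) (es′ , es′↭es , cs)
    with contraction-map cs
  ... | M , M-rep , loops = subst (λ l → order H′ ℕ.+ l ℕ.≤ suc (order H)) (length-map (source H) es)
    (shrink M (M (source H e)) (image-unique (rep H)) (image-unique (rep H′)) uniq sources-in collapse cover)
    where
    loops′ : All (λ f → M (source H f) ≡ M (target H f)) es
    loops′ = Perm.All-resp-↭ es′↭es loops
    sources-equal : All (λ f → M (source H f) ≡ M (source H e)) es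
    -- The linked list repeats e at its end, so the hypothesis on e is appended and the last
    -- conclusion dropped.
    sources-equal = All.++⁻ˡ es (linked-collapse H M lnk (All.∷ʳ⁺ loops′ (All.head loops′)))
    sources-in : map (source H) es ⊆ image (rep H)
    sources-in z∈ with ∈-map⁻ (source H) z∈
    ... | f , _ , refl = ∈-image⁺ (rep H) (src f)
    collapse : ∀ {c} → c ∈ map (source H) es → M c ≡ M (source H e)
    collapse c∈ with ∈-map⁻ (source H) c∈
    ... | f , f∈ , refl = All.lookup sources-equal f∈
    cover : ∀ {y} → y ∈ image (rep H′) → ∃[ x ] (x ∈ image (rep H) × y ≡ M x)
    cover y∈ with ∈-image⁻ (rep H′) y∈
    ... | w , refl = rep H w , ∈-image⁺ (rep H) w , M-rep w

  -- Short cycles and the size of an SCSS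

  NoCycle : ℕ → Contracted G → Set
  NoCycle i H = ¬ (∃[ es ] (Cycle H es × i ℕ.≤ length es))

  module _ {S : EdgeSet G} (H : Contracted G) where
    open Walks (source H) (target H)

    Useful : Edge G → Set
    Useful e = e ∈ˢ S × ¬ Loop H e

    contracted-walk : ∀ {u v} → Star (Step G S) u v → ∃[ es ] Walk Useful (rep H u) (rep H v) es
    contracted-walk ε = _ , []
    contracted-walk {v = v} (record { edge = e ; chosen = e∈S ; from = refl ; to = refl } ◅ steps) with contracted-walk steps
    ... | es , w with source H e ≟ target H e
    ...   | yes loop  = es , subst (λ u → Walk Useful u (rep H v) es) (sym loop) w
    ...   | no  ¬loop = e ∷ es , cons refl (e∈S , ¬loop) w

    -- A live parallel edge has the same endpoints, so the list of sources, and with it simplicity,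
    -- survives the replacement.
    live-walk : ∀ {u v es} → LiveParallel H → Walk Useful u v es →
      ∃[ fs ] (Walk (_∈ˢ live H) u v fs × map (source H) fs ≡ map (source H) es)
    live-walk lp []                      = [] , [] , refl
    live-walk lp (cons {e = e} refl (_ , ¬loop) w) with lp e ¬loop | live-walk lp w
    ... | f , f∈ , s≡ , t≡ | fs , w′ , eq =
      f ∷ fs , cons (sym s≡) f∈ (subst (λ u → Walk (_∈ˢ live H) u _ fs) t≡ w′) , cong₂ _∷_ (sym s≡) eq

    live-cycle : ∀ {e es} → LiveParallel H → Walk Useful (source H e) (source H e) (e ∷ es) →
      Unique (map (source H) (e ∷ es)) → ∃[ fs ] (Cycle H fs × length fs ≡ suc (length es))
    live-cycle {e} {es} lp w uniq with live-walk lp w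
    ... | f ∷ fs , w′@(cons sf≡ _ _) , eq = f ∷ fs ,
      (edges-satisfy w′ , linked f w′ (sym sf≡) , subst Unique (sym eq) uniq) ,
      trans (sym (length-map (source H) (f ∷ fs))) (trans (cong length eq) (length-map (source H) (e ∷ es)))

    module _ (scss : SCSS G S) where

      connected : ∀ {u v} → u ∈ image (rep H) → v ∈ image (rep H) → ∃[ es ] Walk Useful u v es
      connected u∈ v∈ with ∈-image⁻ (rep H) u∈ | ∈-image⁻ (rep H) v∈
      ... | u , refl | v , refl = contracted-walk (scss u v)

      order-bound : ∀ {a b} → (∀ {e es} → Walk Useful (source H e) (source H e) (e ∷ es) → Unique (map (source H) (e ∷ es)) →
        ∀ {l} → l ℕ.≤ length es → a ℕ.* l ℕ.≤ b ℕ.* suc l) → a ℕ.* order H ℕ.≤ b ℕ.* ∣ S ∣ ℕ.+ a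
      order-bound {a} {b} ear-cost = Ears.spanning-cost {a = a} {b} connected (λ e → ∈-image⁺ (rep H) (tgt e)) ear-cost
        (image-unique (rep H)) (λ uniq useful → Unique-∣∣ uniq (All.map proj₁ useful))

      -- With a = b = 1 the condition on ears is l ≤ l + 1, which holds without any bound on cycles.
      order≤ : order H ℕ.≤ suc ∣ S ∣
      order≤ = ℕ.≤-trans (ℕ.≤-reflexive (sym (ℕ.*-identityˡ (order H))))
        (ℕ.≤-trans (order-bound {1} {1} (λ _ _ {l} _ → ℕ.*-monoʳ-≤ 1 (ℕ.n≤1+n l)))
          (ℕ.≤-reflexive (trans (cong (ℕ._+ 1) (ℕ.*-identityˡ ∣ S ∣)) (ℕ.+-comm ∣ S ∣ 1))))

      -- The weights p + 1 and p make the condition on ears say l ≤ p. If it failed, `live-cycle`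
      -- would give a live cycle with at least p + 2 edges.
      order≤-short-cycles : ∀ p → LiveParallel H → NoCycle (suc (suc p)) H → suc p ℕ.* order H ℕ.≤ p ℕ.* ∣ S ∣ ℕ.+ suc p
      order≤-short-cycles p lp short = order-bound {suc p} {p} ear-cost
        where
        ear-cost : ∀ {e es} → Walk Useful (source H e) (source H e) (e ∷ es) → Unique (map (source H) (e ∷ es)) →
          ∀ {l} → l ℕ.≤ length es → suc p ℕ.* l ℕ.≤ p ℕ.* suc l
        ear-cost {es = es} w uniq {l} l≤ with length es ℕ.≤? p
        ... | yes es≤p = ℕ.≤-trans (ℕ.+-monoˡ-≤ (p ℕ.* l) (ℕ.≤-trans l≤ es≤p)) (ℕ.≤-reflexive (sym (ℕ.*-suc p l)))
        ... | no  es≰p with live-cycle lp w uniq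
        ...   | fs , cycle , len = ⊥-elim (short (fs , cycle , ℕ.≤-trans (s≤s (ℕ.≰⇒> es≰p)) (ℕ.≤-reflexive (sym len))))

  -- Phases and their cost

  phase-liveParallel : ∀ {i H F H′ F′} → Phase G i H F H′ F′ → LiveParallel H → LiveParallel H′
  phase-liveParallel (exit _)                        lp = lp
  phase-liveParallel (step _ _ _ (_ , _ , cs) rest)  lp = phase-liveParallel rest (liveParallel-order cs lp)

  phase-short-cycles : ∀ {i H F H′ F′} → Phase G i H F H′ F′ → NoCycle i H′
  phase-short-cycles (exit none)       = none
  phase-short-cycles (step _ _ _ _ ph) = phase-short-cycles ph

  -- p∣F∣ + (p+1) order is a potential. A cycle of ℓ edges raises the first part by at most p ℓ and
  -- lowers the second by at least (p+1)(ℓ-1), which is no less because ℓ ≥ p + 1. The calculation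
  -- adds (p+1) ℓ to both sides to avoid subtraction.
  phase-cost : ∀ {p H F H′ F′} → Phase G (suc p) H F H′ F′ →
    p ℕ.* ∣ F′ ∣ ℕ.+ suc p ℕ.* order H′ ℕ.≤ p ℕ.* ∣ F ∣ ℕ.+ suc p ℕ.* order H
  phase-cost (exit _) = ℕ.≤-refl
  phase-cost {p} {H} {F} (step {H′ = H₁} es cyc long ce ph) = ℕ.≤-trans (phase-cost ph) (ℕ.+-cancelʳ-≤ (suc p ℕ.* ℓ) _ _ (begin
    p ℕ.* ∣ F₁ ∣ ℕ.+ suc p ℕ.* order H₁ ℕ.+ suc p ℕ.* ℓ
      ≤⟨ ℕ.+-monoˡ-≤ (suc p ℕ.* ℓ) (ℕ.+-monoˡ-≤ (suc p ℕ.* order H₁) (ℕ.*-monoʳ-≤ p F₁≤)) ⟩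
    p ℕ.* (∣ F ∣ ℕ.+ ℓ) ℕ.+ suc p ℕ.* order H₁ ℕ.+ suc p ℕ.* ℓ
      ≡⟨ e₁ p ∣ F ∣ (order H₁) ℓ ⟩
    p ℕ.* ∣ F ∣ ℕ.+ p ℕ.* ℓ ℕ.+ suc p ℕ.* (order H₁ ℕ.+ ℓ)
      ≤⟨ ℕ.+-monoʳ-≤ (p ℕ.* ∣ F ∣ ℕ.+ p ℕ.* ℓ) (ℕ.*-monoʳ-≤ (suc p) (contract-cycle-order es cyc ce)) ⟩
    p ℕ.* ∣ F ∣ ℕ.+ p ℕ.* ℓ ℕ.+ suc p ℕ.* suc (order H)
      ≡⟨ e₂ p ∣ F ∣ (order H) ℓ ⟩
    p ℕ.* ∣ F ∣ ℕ.+ suc p ℕ.* order H ℕ.+ (suc p ℕ.+ p ℕ.* ℓ)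
      ≤⟨ ℕ.+-monoʳ-≤ (p ℕ.* ∣ F ∣ ℕ.+ suc p ℕ.* order H) (ℕ.+-monoˡ-≤ (p ℕ.* ℓ) long) ⟩
    p ℕ.* ∣ F ∣ ℕ.+ suc p ℕ.* order H ℕ.+ suc p ℕ.* ℓ ∎))
    where
    open ℕ.≤-Reasoning
    ℓ = length es
    F₁ = F ∪ ⋃ (map ⁅_⁆ es)
    F₁≤ : ∣ F₁ ∣ ℕ.≤ ∣ F ∣ ℕ.+ ℓ
    F₁≤ = ℕ.≤-trans (∣∪∣≤ F _) (ℕ.+-monoʳ-≤ ∣ F ∣ (∣⋃⁅⁆∣≤ es))
    e₁ : ∀ p f n l → p ℕ.* (f ℕ.+ l) ℕ.+ suc p ℕ.* n ℕ.+ suc p ℕ.* l ≡ p ℕ.* f ℕ.+ p ℕ.* l ℕ.+ suc p ℕ.* (n ℕ.+ l)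
    e₁ = solveℕ
    e₂ : ∀ p f n l → p ℕ.* f ℕ.+ p ℕ.* l ℕ.+ suc p ℕ.* suc n ≡ p ℕ.* f ℕ.+ suc p ℕ.* n ℕ.+ (suc p ℕ.+ p ℕ.* l)
    e₂ = solveℕ

∈⇒length : ∀ {A : Set} {x : A} {xs : List A} → x ∈ xs → ∃[ l ] length xs ≡ suc l
∈⇒length {xs = _ ∷ xs} _ = length xs , refl

phase-arith : ∀ j f f′ ν ν′ → suc j ℕ.* f′ ℕ.+ suc (suc j) ℕ.* suc ν′ ℕ.≤ suc j ℕ.* f ℕ.+ suc (suc j) ℕ.* suc ν →
  ι f′ ℚ.+ (1ℚ ℚ.+ inv j) ℚ.* ι ν′ ℚ.≤ ι f ℚ.+ (1ℚ ℚ.+ inv j) ℚ.* ι ν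
phase-arith j f f′ ν ν′ le = begin
  ι f′ ℚ.+ (1ℚ ℚ.+ i) ℚ.* ι ν′                      ≡⟨ scaled f′ ν′ ⟨
  i ℚ.* ι (suc j ℕ.* f′ ℕ.+ suc (suc j) ℕ.* ν′)     ≤⟨ ℚ.*-monoˡ-≤-nonNeg i {{inv-nonNeg j}} (ι-mono le′) ⟩
  i ℚ.* ι (suc j ℕ.* f ℕ.+ suc (suc j) ℕ.* ν)       ≡⟨ scaled f ν ⟩
  ι f ℚ.+ (1ℚ ℚ.+ i) ℚ.* ι ν                        ∎
  where
  open ℚ.≤-Reasoning
  open +-*-Solver
  i = inv j
  shift : ∀ j f ν → suc j ℕ.* f ℕ.+ suc (suc j) ℕ.* suc ν ≡ suc j ℕ.* f ℕ.+ suc (suc j) ℕ.* ν ℕ.+ suc (suc j)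
  shift = solveℕ
  le′ : suc j ℕ.* f′ ℕ.+ suc (suc j) ℕ.* ν′ ℕ.≤ suc j ℕ.* f ℕ.+ suc (suc j) ℕ.* ν
  le′ = ℕ.+-cancelʳ-≤ (suc (suc j)) _ _ (subst₂ ℕ._≤_ (shift j f′ ν′) (shift j f ν) le)
  scaled : ∀ f ν → i ℚ.* ι (suc j ℕ.* f ℕ.+ suc (suc j) ℕ.* ν) ≡ ι f ℚ.+ (1ℚ ℚ.+ i) ℚ.* ι ν
  scaled f ν = begin-equality
    i ℚ.* ι (suc j ℕ.* f ℕ.+ suc (suc j) ℕ.* ν)
      ≡⟨ cong (i ℚ.*_) (trans (ι-+ (suc j ℕ.* f) (suc (suc j) ℕ.* ν)) (cong₂ ℚ._+_ (ι-* (suc j) f) (trans (ι-* (suc (suc j)) ν) (cong (ℚ._* ι ν) (ι-+ 1 (suc j)))))) ⟩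
    i ℚ.* (ι (suc j) ℚ.* ι f ℚ.+ (1ℚ ℚ.+ ι (suc j)) ℚ.* ι ν)
      ≡⟨ solve 4 (λ i p f n → i :* (p :* f :+ (con 1ℚ :+ p) :* n) := (p :* i) :* f :+ (i :+ p :* i) :* n) refl i (ι (suc j)) (ι f) (ι ν) ⟩
    (ι (suc j) ℚ.* i) ℚ.* ι f ℚ.+ (i ℚ.+ ι (suc j) ℚ.* i) ℚ.* ι ν
      ≡⟨ cong (λ q → q ℚ.* ι f ℚ.+ (i ℚ.+ q) ℚ.* ι ν) (ι*inv j) ⟩
    1ℚ ℚ.* ι f ℚ.+ (i ℚ.+ 1ℚ) ℚ.* ι ν
      ≡⟨ solve 3 (λ i f n → con 1ℚ :* f :+ (i :+ con 1ℚ) :* n := f :+ (con 1ℚ :+ i) :* n) refl i (ι f) (ι ν) ⟩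
    ι f ℚ.+ (1ℚ ℚ.+ i) ℚ.* ι ν ∎

order-arith : ∀ l o ν → suc (suc l) ℕ.* suc ν ℕ.≤ suc l ℕ.* o ℕ.+ suc (suc l) →
  inv l ℚ.* ι ν ℚ.≤ inv (suc l) ℚ.* ι o
order-arith l o ν le = begin
  a ℚ.* ι ν                                ≡⟨ ℚ.*-identityʳ (a ℚ.* ι ν) ⟨
  a ℚ.* ι ν ℚ.* 1ℚ                         ≡⟨ cong (a ℚ.* ι ν ℚ.*_) (ι*inv (suc l)) ⟨
  a ℚ.* ι ν ℚ.* (q ℚ.* b)                  ≡⟨ solve 4 (λ a b n q → a :* n :* (q :* b) := a :* b :* (q :* n)) refl a b (ι ν) q ⟩
  a ℚ.* b ℚ.* (q ℚ.* ι ν)                  ≡⟨ cong (a ℚ.* b ℚ.*_) (ι-* (suc (suc l)) ν) ⟨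
  a ℚ.* b ℚ.* ι (suc (suc l) ℕ.* ν)        ≡⟨ cong (ℚ._* ι (suc (suc l) ℕ.* ν)) (inv-* l (suc l)) ⟩
  c ℚ.* ι (suc (suc l) ℕ.* ν)              ≤⟨ ℚ.*-monoˡ-≤-nonNeg c {{inv-nonNeg (suc l ℕ.+ l ℕ.* suc (suc l))}} (ι-mono le′) ⟩
  c ℚ.* ι (suc l ℕ.* o)                    ≡⟨ cong₂ ℚ._*_ (sym (inv-* l (suc l))) (ι-* (suc l) o) ⟩
  a ℚ.* b ℚ.* (p ℚ.* ι o)                  ≡⟨ solve 4 (λ a b p o → a :* b :* (p :* o) := p :* a :* (b :* o)) refl a b p (ι o) ⟩
  p ℚ.* a ℚ.* (b ℚ.* ι o)                  ≡⟨ cong (ℚ._* (b ℚ.* ι o)) (ι*inv l) ⟩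
  1ℚ ℚ.* (b ℚ.* ι o)                       ≡⟨ ℚ.*-identityˡ (b ℚ.* ι o) ⟩
  b ℚ.* ι o                                ∎
  where
  open ℚ.≤-Reasoning
  open +-*-Solver
  a = inv l
  b = inv (suc l)
  c = inv (suc l ℕ.+ l ℕ.* suc (suc l))
  p = ι (suc l)
  q = ι (suc (suc l))
  le′ : suc (suc l) ℕ.* ν ℕ.≤ suc l ℕ.* o
  le′ = ℕ.+-cancelʳ-≤ (suc (suc l)) _ _ (ℕ.≤-trans (ℕ.≤-reflexive (trans (ℕ.+-comm _ (suc (suc l))) (sym (ℕ.*-suc (suc (suc l)) ν)))) le)

-- One step of the summation by parts: the current phase charges 1 + b per vertex removed, the next
-- one 1 + a. As a = b + a b, the n′ vertices passed on cost b (a n′) more than at the current rate,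
-- which is at most b² o.
run-recurrence : ∀ {f f₁ f₂ o n n′ a b z} →
  f₁ ℚ.+ (1ℚ ℚ.+ b) ℚ.* n′ ℚ.≤ f ℚ.+ (1ℚ ℚ.+ b) ℚ.* n →
  f₂ ℚ.+ o ℚ.≤ f₁ ℚ.+ (1ℚ ℚ.+ a) ℚ.* n′ ℚ.+ z ℚ.* o →
  a ≡ b ℚ.+ a ℚ.* b → 0ℚ ℚ.≤ b → a ℚ.* n′ ℚ.≤ b ℚ.* o →
  f₂ ℚ.+ o ℚ.≤ f ℚ.+ (1ℚ ℚ.+ b) ℚ.* n ℚ.+ (z ℚ.+ b ℚ.* b) ℚ.* o
run-recurrence {f} {f₁} {f₂} {o} {n} {n′} {a} {b} {z} phase≤ run≤ a≡ 0≤b order≤ = begin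
  f₂ ℚ.+ o                                                         ≤⟨ run≤ ⟩
  f₁ ℚ.+ (1ℚ ℚ.+ a) ℚ.* n′ ℚ.+ z ℚ.* o                             ≡⟨ cong (λ c → f₁ ℚ.+ (1ℚ ℚ.+ c) ℚ.* n′ ℚ.+ z ℚ.* o) a≡ ⟩
  f₁ ℚ.+ (1ℚ ℚ.+ (b ℚ.+ a ℚ.* b)) ℚ.* n′ ℚ.+ z ℚ.* o
    ≡⟨ solve 6 (λ f₁ n′ a b z o → f₁ :+ (con 1ℚ :+ (b :+ a :* b)) :* n′ :+ z :* o :=
         (f₁ :+ (con 1ℚ :+ b) :* n′) :+ (b :* (a :* n′) :+ z :* o)) refl f₁ n′ a b z o ⟩
  (f₁ ℚ.+ (1ℚ ℚ.+ b) ℚ.* n′) ℚ.+ (b ℚ.* (a ℚ.* n′) ℚ.+ z ℚ.* o)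
    ≤⟨ ℚ.+-mono-≤ phase≤ (ℚ.+-monoˡ-≤ (z ℚ.* o) (ℚ.*-monoˡ-≤-nonNeg b {{ℚ.nonNegative 0≤b}} order≤)) ⟩
  (f ℚ.+ (1ℚ ℚ.+ b) ℚ.* n) ℚ.+ (b ℚ.* (b ℚ.* o) ℚ.+ z ℚ.* o)
    ≡⟨ solve 5 (λ f n b z o → (f :+ (con 1ℚ :+ b) :* n) :+ (b :* (b :* o) :+ z :* o) :=
         f :+ (con 1ℚ :+ b) :* n :+ (z :+ b :* b) :* o) refl f n b z o ⟩
  f ℚ.+ (1ℚ ℚ.+ b) ℚ.* n ℚ.+ (z ℚ.+ b ℚ.* b) ℚ.* o                 ∎
  where
  open ℚ.≤-Reasoning
  open +-*-Solver

module _ (G : Digraph) {S : EdgeSet G} (scss : SCSS G S) (w₀ : Vertex G) where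

  nonempty : ∀ H → ∃[ ν ] order G H ≡ suc ν
  nonempty H = ∈⇒length (∈-image⁺ (Contracted.rep H) w₀)

  -- The summand for S on the left offsets the leading term 1 of ζ, so that the last phase, i = 2,
  -- fits the formula with `ζ 1`.
  run-cost : ∀ j {H F F′ ν} → order G H ≡ suc ν → LiveParallel G H → Run G (suc (suc j)) H F F′ →
    ι ∣ F′ ∣ ℚ.+ ι ∣ S ∣ ℚ.≤ ι ∣ F ∣ ℚ.+ (1ℚ ℚ.+ inv j) ℚ.* ι ν ℚ.+ ζ (suc j) ℚ.* ι ∣ S ∣
  run-cost j {F = F} {ν = ν} order≡ lp (phase {H′ = H₁} {F′ = F₁} _ ph rest) with nonempty H₁
  ... | ν₁ , order₁≡ = go j rest phase≤ order₁≤
    where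
    phase≤ : suc j ℕ.* ∣ F₁ ∣ ℕ.+ suc (suc j) ℕ.* suc ν₁ ℕ.≤ suc j ℕ.* ∣ F ∣ ℕ.+ suc (suc j) ℕ.* suc ν
    phase≤ = subst₂ (λ x y → suc j ℕ.* ∣ F₁ ∣ ℕ.+ suc (suc j) ℕ.* x ℕ.≤ suc j ℕ.* ∣ F ∣ ℕ.+ suc (suc j) ℕ.* y)
      order₁≡ order≡ (phase-cost G ph)
    lp₁ : LiveParallel G H₁
    lp₁ = phase-liveParallel G ph lp
    order₁≤ : suc j ℕ.* suc ν₁ ℕ.≤ j ℕ.* ∣ S ∣ ℕ.+ suc j
    order₁≤ = subst (λ x → suc j ℕ.* x ℕ.≤ j ℕ.* ∣ S ∣ ℕ.+ suc j) order₁≡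
      (order≤-short-cycles G H₁ scss j lp₁ (phase-short-cycles G ph))
    -- Here j can be split: at 0 the run has to return, and otherwise one more phase follows.
    go : ∀ j {F₂} → Run G (suc j) H₁ F₁ F₂ →
      suc j ℕ.* ∣ F₁ ∣ ℕ.+ suc (suc j) ℕ.* suc ν₁ ℕ.≤ suc j ℕ.* ∣ F ∣ ℕ.+ suc (suc j) ℕ.* suc ν →
      suc j ℕ.* suc ν₁ ℕ.≤ j ℕ.* ∣ S ∣ ℕ.+ suc j →
      ι ∣ F₂ ∣ ℚ.+ ι ∣ S ∣ ℚ.≤ ι ∣ F ∣ ℚ.+ (1ℚ ℚ.+ inv j) ℚ.* ι ν ℚ.+ ζ (suc j) ℚ.* ι ∣ S ∣
    go zero (phase (s≤s ()) _ _) _ _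
    go zero return phase≤ _ = begin
      ι ∣ F₁ ∣ ℚ.+ ι ∣ S ∣
        ≤⟨ ℚ.+-monoˡ-≤ (ι ∣ S ∣) (ℚ.≤-trans (ℚ.≤-reflexive (sym (ℚ.+-identityʳ (ι ∣ F₁ ∣))))
             (ℚ.+-monoʳ-≤ (ι ∣ F₁ ∣) (ℚ.*-monoˡ-≤-nonNeg (1ℚ ℚ.+ inv 0) (ι-mono {0} {ν₁} z≤n)))) ⟩
      ι ∣ F₁ ∣ ℚ.+ (1ℚ ℚ.+ inv 0) ℚ.* ι ν₁ ℚ.+ ι ∣ S ∣
        ≤⟨ ℚ.+-monoˡ-≤ (ι ∣ S ∣) (phase-arith 0 (∣ F ∣) (∣ F₁ ∣) ν ν₁ phase≤) ⟩
      ι ∣ F ∣ ℚ.+ (1ℚ ℚ.+ inv 0) ℚ.* ι ν ℚ.+ ι ∣ S ∣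
        ≡⟨ cong (ι ∣ F ∣ ℚ.+ (1ℚ ℚ.+ inv 0) ℚ.* ι ν ℚ.+_) (ℚ.*-identityˡ (ι ∣ S ∣)) ⟨
      ι ∣ F ∣ ℚ.+ (1ℚ ℚ.+ inv 0) ℚ.* ι ν ℚ.+ ζ 1 ℚ.* ι ∣ S ∣ ∎
      where open ℚ.≤-Reasoning
    go (suc l) {F₂} rest phase≤ order≤ =
      run-recurrence {ι ∣ F ∣} {ι ∣ F₁ ∣} {ι ∣ F₂ ∣} {ι ∣ S ∣} {ι ν} {ι ν₁} {inv l} {inv (suc l)} {ζ (suc l)}
        (phase-arith (suc l) (∣ F ∣) (∣ F₁ ∣) ν ν₁ phase≤) (run-cost l order₁≡ lp₁ rest)
        (inv-telescope l) (0≤inv (suc l)) (order-arith l (∣ S ∣) ν₁ order≤)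

  -- Initially ν ≤ ∣S∣, so the vertices cost at most (1 + 1/(j+1))∣S∣. Cancelling the ∣S∣ on the
  -- left of `run-cost` leaves the factor ζ(j+1) + 1/(j+1).
  contractCycles-cost : ∀ j F → ContractCycles (suc (suc j)) G F → ι ∣ F ∣ ℚ.≤ upper j ℚ.* ι ∣ S ∣
  contractCycles-cost j F run with nonempty (uncontracted G)
  ... | ν , order≡ = cancel {ι ∣ F ∣} {ι ∣ S ∣} {ι ν} {inv j} {ζ (suc j)} (0≤inv j)
    (ι-mono (ℕ.≤-pred (subst (ℕ._≤ suc ∣ S ∣) order≡ (order≤ G (uncontracted G) scss))))
    (subst (λ z → ι ∣ F ∣ ℚ.+ ι ∣ S ∣ ℚ.≤ ι z ℚ.+ (1ℚ ℚ.+ inv j) ℚ.* ι ν ℚ.+ ζ (suc j) ℚ.* ι ∣ S ∣) (∣⊥∣≡0 (Digraph.#E G))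
      (run-cost j order≡ (λ e _ → e , ∈⊤ , refl , refl) run))
    where
    cancel : ∀ {f o n a z} → 0ℚ ℚ.≤ a → n ℚ.≤ o → f ℚ.+ o ℚ.≤ 0ℚ ℚ.+ (1ℚ ℚ.+ a) ℚ.* n ℚ.+ z ℚ.* o → f ℚ.≤ (z ℚ.+ a) ℚ.* o
    cancel {f} {o} {n} {a} {z} 0≤a n≤o le = begin
      f                                                   ≡⟨ solve 2 (λ f o → f := (f :+ o) :- o) refl f o ⟩
      (f ℚ.+ o) ℚ.- o                                     ≤⟨ ℚ.+-monoˡ-≤ (ℚ.- o) le ⟩
      (0ℚ ℚ.+ (1ℚ ℚ.+ a) ℚ.* n ℚ.+ z ℚ.* o) ℚ.- o
        ≡⟨ solve 4 (λ o n a z → (con 0ℚ :+ (con 1ℚ :+ a) :* n :+ z :* o) :- o := (n :+ a :* n) :+ (z :* o :- o)) refl o n a z ⟩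
      (n ℚ.+ a ℚ.* n) ℚ.+ (z ℚ.* o ℚ.- o)
        ≤⟨ ℚ.+-monoˡ-≤ (z ℚ.* o ℚ.- o) (ℚ.+-mono-≤ n≤o (ℚ.*-monoˡ-≤-nonNeg a {{ℚ.nonNegative 0≤a}} n≤o)) ⟩
      (o ℚ.+ a ℚ.* o) ℚ.+ (z ℚ.* o ℚ.- o)
        ≡⟨ solve 3 (λ o a z → (o :+ a :* o) :+ (z :* o :- o) := (z :+ a) :* o) refl o a z ⟩
      (z ℚ.+ a) ℚ.* o                                     ∎
      where
      open ℚ.≤-Reasoning
      open +-*-Solver

inhabited? : ∀ n → Fin n ⊎ ¬ Fin n
inhabited? zero    = inj₂ λ ()
inhabited? (suc n) = inj₁ zero

∣∣-empty : ∀ {n} → ¬ Fin n → (F : Subset n) → ∣ F ∣ ≡ 0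
∣∣-empty _  []      = refl
∣∣-empty ¬i (_ ∷ _) = ⊥-elim (¬i zero)

upper-nonNeg : ∀ j → 0ℚ ℚ.≤ upper j
upper-nonNeg j = ℚ.≤-trans (ζ-mono {0} {suc j} z≤n) (ζ≤upper {j} {suc j} ℕ.≤-refl)

-- A graph without vertices is treated apart, since its order is no successor; it has no edges, so F
-- is empty.
contractCycles-bound : ∀ j G F → ContractCycles (suc (suc j)) G F → ∀ o → OPT G o → ι ∣ F ∣ ℚ.≤ upper j ℚ.* ι o
contractCycles-bound j G F run o opt with OPT.attained opt | inhabited? (Digraph.#V G)
... | S , scss , refl | inj₁ w  = contractCycles-cost G scss w j F run
... | S , _    , refl | inj₂ ¬w = begin
  ι ∣ F ∣             ≡⟨ cong ι (∣∣-empty (λ e → ¬w (Digraph.src G e)) F) ⟩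
  0ℚ                  ≡⟨ ℚ.*-zeroˡ (ι o) ⟨
  0ℚ ℚ.* ι o          ≤⟨ ℚ.*-monoʳ-≤-nonNeg (ι o) {{ι-nonNeg o}} (upper-nonNeg j) ⟩
  upper j ℚ.* ι o     ∎
  where open ℚ.≤-Reasoning

≤⇒≤ʳ : ∀ p q r → p ℚ.≤ q ℚ.* r → fromℚ p ≤ʳ fromℚ q *ʳ fromℚ r
≤⇒≤ʳ p q r p≤qr δ δ>0 = 0 , λ _ _ → ℚ.≤-trans p≤qr
  (ℚ.≤-trans (ℚ.≤-reflexive (sym (ℚ.+-identityʳ (q ℚ.* r)))) (ℚ.+-monoʳ-≤ (q ℚ.* r) (ℚ.<⇒≤ δ>0)))

open import Data.Nat.Base using (_≤_)

theorem4p1 : ∀ k → (2≤k : 2 ≤ k) →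
    ∃[ c ] (π²/6 ≤ʳ c × c ≤ʳ π²/6 +ʳ 1/[k-1]k k 2≤k ×
    (∀ (G : Digraph) → StronglyConnected G →
    ∀ F → ContractCycles k G F →
    ∀ o → OPT G o →
    fromℕ ∣ F ∣ ≤ʳ c *ʳ fromℕ o))
theorem4p1 (suc zero)    (s≤s ())
theorem4p1 (suc (suc j)) 2≤k = fromℚ (upper j) , π²/6≤upper j , upper≤π²/6+ j 2≤k ,
  λ G _ F run o opt → ≤⇒≤ʳ (ι ∣ F ∣) (upper j) (ι o) (contractCycles-bound j G F run o opt)
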